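{- Let $r\ge 1$ and let $A=\{a(1),\dots,a(r)\}$ be a set of $r$ distinct integers such that $\sum_{i=1}^{k-1}a(i)<a(k)$ for all $1\le k\le r$ and such that the $2^r-1$ sums of nonempty subsets of $A$ are pairwise distinct. Let $A'=\{\alpha(1)<\dots<\alpha(2^r-1)\}$ be the set of these sums, and let $N$ be a positive integer with $N\ge \alpha(2^r-1)=a(1)+\dots+a(r)$. Let $A_N$ be the set of positive integers congruent modulo $N$ to some $a(i)$, and $A'_N$ the set of positive integers congruent modulo $N$ to some $\alpha(i)$. Let $D(A_N;k,n)$ be the number of overpartitions of $n$ into parts taken from $A_N$ having exactly $k$ non-overlined parts. Let $E(A'_N;k,n)$ be the number of overpartitions $n=\lambda_1+\dots+\lambda_s$ of $n$ into parts taken from $A'_N$, having exactly $k$ non-overlined parts, such that for all $1\le i\le s-1$, $$\lambda_i-\lambda_{i+1}\ \ge\ N\big(w(\beta_N(\lambda_{i+1}))-1+\chi(\overline{\lambda_{i+1}})\big)+v(\beta_N(\lambda_{i+1}))-\beta_N(\lambda_{i+1}).$$ Then $D(A_N;k,n)=E(A'_N;k,n)$ for all $k,n$.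
   Context: An overpartition of $n$ is a partition of $n$ (a non-increasing sequence of positive integers summing to $n$) in which the first occurrence of each part size may be overlined; it is written $\lambda_1\ge\lambda_2\ge\dots\ge\lambda_s$ with, among equal part sizes, the overlined one (if any) listed first. For $\alpha\in A'$, $w(\alpha)$ denotes the number of elements of $A$ in the (unique) subset of $A$ whose sum is $\alpha$, and $v(\alpha)$ denotes the smallest element of that subset. $\beta_N(m)$ denotes the least positive residue of $m$ modulo $N$ (an element of $\{1,\dots,N\}$). $\chi(\overline{\lambda_{i+1}})=1$ if $\lambda_{i+1}$ is overlined and $0$ otherwise. -}

module Defs where

open import Data.Bool using (Bool; true; false; not; _∧_; _∨_; if_then_else_)
open import Data.Nat using (ℕ; zero; suc; _+_; _∸_; _%_; _⊓_; _≡ᵇ_; _<ᵇ_)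
open import Data.Nat as ℕ using ()
open import Data.Integer as ℤ using (ℤ; +_)
open import Data.Fin using (Fin)
import Data.Fin as Fin
open import Data.Fin.Subset using (Subset)
open import Data.List using (List; []; _∷_; _++_; map; concatMap; filterᵇ; length; foldr; upTo; allFin; findᵇ)
open import Data.Nat.ListAction using (sum)
open import Data.Bool.ListAction using (any; all)
import Data.Vec as Vec
open import Data.Vec using (Vec)
open import Data.Product using (_×_; _,_; proj₁; proj₂)
open import Data.Maybe using (Maybe; just; nothing; maybe)

-- m mod N (for N = 0 we just return m; the theorem assumes N ≥ 1)
_mod_ : ℕ → ℕ → ℕ
m mod zero = m
m mod suc n = m % suc n

-- β_N(m): least positive residue of m modulo N, an element of {1,…,N}
β : ℕ → ℕ → ℕ
β N m = suc ((m ∸ 1) mod N)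

-- minimum of a list (0 for the empty list; only used on nonempty lists)
minL : List ℕ → ℕ
minL [] = 0
minL (x ∷ xs) = foldr _⊓_ x xs

selected : ∀ {r} → (Fin r → ℕ) → Subset r → List ℕ
selected {zero} a Vec.[] = []
selected {suc r} a (true Vec.∷ S) = a Fin.zero ∷ selected (λ i → a (Fin.suc i)) S
selected {suc r} a (false Vec.∷ S) = selected (λ i → a (Fin.suc i)) S

subsetSum : ∀ {r} → (Fin r → ℕ) → Subset r → ℕ
subsetSum a S = sum (selected a S)

nonemptyᵇ : ∀ {r} → Subset r → Bool
nonemptyᵇ S = any (λ b → b) (Vec.toList S)

allSubsets : (r : ℕ) → List (Subset r)
allSubsets zero = Vec.[] ∷ []
allSubsets (suc r) = map (true Vec.∷_) (allSubsets r) ++ map (false Vec.∷_) (allSubsets r)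

A′ : ∀ {r} → (Fin r → ℕ) → List ℕ
A′ {r} a = map (subsetSum a) (filterᵇ nonemptyᵇ (allSubsets r))

-- the (unique, under the hypotheses) nonempty subset of A with sum α
subsetOf : ∀ {r} → (Fin r → ℕ) → ℕ → Maybe (Subset r)
subsetOf {r} a α = findᵇ (λ S → nonemptyᵇ S ∧ (subsetSum a S ≡ᵇ α)) (allSubsets r)

w : ∀ {r} → (Fin r → ℕ) → ℕ → ℕ
w a α = maybe (λ S → length (selected a S)) 0 (subsetOf a α)

v : ∀ {r} → (Fin r → ℕ) → ℕ → ℕ
v a α = maybe (λ S → minL (selected a S)) 0 (subsetOf a α)

-- Overpartitions: lists of parts (size , overlined?)

Part : Set
Part = ℕ × Bool

OP : Set
OP = List Part

-- non-increasing; among equal sizes at most one overlined, listed first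
orderedᵇ : OP → Bool
orderedᵇ [] = true
orderedᵇ (p ∷ []) = true
orderedᵇ ((x , b) ∷ (y , c) ∷ rest) =
  ((y <ᵇ x) ∨ ((x ≡ᵇ y) ∧ not c)) ∧ orderedᵇ ((y , c) ∷ rest)

isOverpartitionᵇ : ℕ → OP → Bool
isOverpartitionᵇ n λs =
  all (λ p → 1 ℕ.≤ᵇ proj₁ p) λs ∧ (sum (map proj₁ λs) ≡ᵇ n) ∧ orderedᵇ λs

nonOverlined : OP → ℕ
nonOverlined λs = length (filterᵇ (λ p → not (proj₂ p)) λs)

partChoices : ℕ → List Part
partChoices n = concatMap (λ x → (suc x , true) ∷ (suc x , false) ∷ []) (upTo n)

seqs : ℕ → ℕ → List OP
seqs n zero = [] ∷ []
seqs n (suc l) = [] ∷ concatMap (λ p → map (p ∷_) (seqs n l)) (partChoices n)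

-- a finite list containing every overpartition of n exactly once
-- (an overpartition of n has at most n parts, each of size ≤ n)
candidates : ℕ → List OP
candidates n = seqs n n

countOP : (OP → Bool) → ℕ → ℕ → ℕ
countOP P k n =
  length (filterᵇ (λ λs → isOverpartitionᵇ n λs ∧ (nonOverlined λs ≡ᵇ k) ∧ P λs)
                  (candidates n))

adjacentᵇ : (Part → Part → Bool) → OP → Bool
adjacentᵇ R [] = true
adjacentᵇ R (p ∷ []) = true
adjacentᵇ R (p ∷ q ∷ rest) = R p q ∧ adjacentᵇ R (q ∷ rest)

inA-Nᵇ : ∀ {r} → (Fin r → ℕ) → ℕ → ℕ → Bool
inA-Nᵇ {r} a N x = (1 ℕ.≤ᵇ x) ∧ any (λ i → (x mod N) ≡ᵇ (a i mod N)) (allFin r)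

inA′-Nᵇ : ∀ {r} → (Fin r → ℕ) → ℕ → ℕ → Bool
inA′-Nᵇ a N x = (1 ℕ.≤ᵇ x) ∧ any (λ α → (x mod N) ≡ᵇ (α mod N)) (A′ a)

χ : Bool → ℤ
χ true = ℤ.1ℤ
χ false = ℤ.0ℤ

gapᵇ : ∀ {r} → (Fin r → ℕ) → ℕ → Part → Part → Bool
gapᵇ a N (x , b) (y , c) =
  let βy = β N y in
  ((+ N) ℤ.* ((+ w a βy) ℤ.- ℤ.1ℤ ℤ.+ χ c) ℤ.+ (+ v a βy) ℤ.- (+ βy))
    ℤ.≤ᵇ ((+ x) ℤ.- (+ y))

D : ∀ {r} → (Fin r → ℕ) → ℕ → ℕ → ℕ → ℕ
D a N = countOP (λ λs → all (λ p → inA-Nᵇ a N (proj₁ p)) λs)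

E : ∀ {r} → (Fin r → ℕ) → ℕ → ℕ → ℕ → ℕ
E a N = countOP (λ λs → all (λ p → inA′-Nᵇ a N (proj₁ p)) λs ∧ adjacentᵇ (gapᵇ a N) λs)

{-# OPTIONS --safe #-}
module Submission where

open import Defs
open import Data.Bool using (Bool; true; false; not; T; T?; _∧_; _∨_)
open import Data.Bool.ListAction using (all)
open import Data.Bool.Properties using (T-≡; T-∧; T-∨)
open import Data.Empty using (⊥; ⊥-elim)
open import Data.Fin using (Fin; toℕ; zero; suc)
import Data.Fin as Fin
open import Data.Fin.Properties using (toℕ-injective)
open import Data.Fin.Subset using (Subset; Nonempty)
open import Data.Integer as ℤ using (ℤ; 0ℤ)
import Data.Integer.Properties as ℤ
import Data.Integer.Tactic.RingSolver as ℤ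
open import Data.List hiding (any; all; sum; find; [_])
open import Data.List.Properties hiding (sum-++)
open import Data.List.Membership.Propositional using (_∈_; find; lose)
open import Data.List.Membership.Propositional.Properties
open import Data.List.Relation.Binary.Permutation.Propositional using (↭-sym)
open import Data.List.Relation.Binary.Permutation.Propositional.Properties using (All-resp-↭; ↭-reverse)
open import Data.List.Relation.Unary.All as All using (All; []; _∷_)
import Data.List.Relation.Unary.All.Properties as All
open import Data.List.Relation.Unary.AllPairs as AllPairs using (AllPairs; []; _∷_)
import Data.List.Relation.Unary.AllPairs.Properties as AllPairs
open import Data.List.Relation.Unary.Any using (here; there)
import Data.List.Relation.Unary.Any.Properties as Any
open import Data.List.Relation.Unary.Linked using (Linked; []; [-]; _∷_)
open import Data.List.Relation.Unary.Linked.Properties using (Linked⇒AllPairs; AllPairs⇒Linked)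
open import Data.List.Relation.Unary.Unique.Propositional using (Unique)
import Data.List.Relation.Unary.Unique.Propositional.Properties as Unique
open import Data.Maybe using (just)
open import Data.Nat
open import Data.Nat.DivMod hiding (_mod_)
open import Data.Nat.ListAction using (sum)
open import Data.Nat.ListAction.Properties using (sum-++; sum-↭)
open import Data.Nat.Properties
open import Data.Nat.Tactic.RingSolver using (solve-∀)
open import Data.Product using (Σ; ∃; ∃₂; _×_; _,_; proj₁; proj₂)
open import Data.Sum using (_⊎_; inj₁; inj₂)
open import Data.Unit using (⊤; tt)
open import Data.Vec using ([]; _∷_; here; there)
open import Function using (Equivalence; _∘_; flip)
open import Function.Definitions using (Injective)
open import Relation.Nullary using (yes; no)
open import Relation.Binary.PropositionalEquality hiding ([_])

-- A part mN + α(T) of an E-overpartition is a block of level m. Read the blocks from the smallest part upwards,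
-- each set T in decreasing order: this gives a word u in the colours. The gap condition says that each letter
-- either is merged into the preceding block, which is possible only at a descent of u, or starts a block of level
-- at least h, respectively h + 1 at a descent, where h = level + |T| − 1 + overline of the preceding block.
-- So for a fixed word the E-overpartitions are free data (Code).
-- A D-overpartition has a word too: the colours of its non-overlined parts in increasing order, followed by those
-- of its overlined parts in decreasing order. For a fixed word with n letters it is given by the increments
-- σ of the levels of the former and τ of the latter, two arbitrary lists with |σ| + |τ| = n.
-- For each word a bijection between the codes and the pairs (τ , σ), in the spirit of Carlitz insertion, is built
-- letter by letter; it maintains h = max (Σσ + number of descents, |τ| + Στ) and preserves the sum of the levels,
-- and |σ| is the number of non-overlined parts on both sides.

-- The bijection for a fixed word

bit : Bool → ℕ
bit true  = 1
bit false = 0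

descents : List Bool → ℕ
descents δ = sum (map bit δ)

descents≤length : ∀ δ → descents δ ≤ length δ
descents≤length []          = z≤n
descents≤length (true ∷ δ)  = s≤s (descents≤length δ)
descents≤length (false ∷ δ) = m≤n⇒m≤1+n (descents≤length δ)

-- The list δ records, last letter first, which letters of a word are smaller than their predecessor.
-- A letter either starts a block t above the least admissible level (new, with χ its overline)
-- or, at a descent, is merged into the current block (mrg).
data Code : List Bool → Set where
  ε   : Code []
  new : ∀ {b δ} (c : Code δ) (t : ℕ) (χ : Bool) → Code (b ∷ δ)
  mrg : ∀ {b δ} → b ≡ true → (c : Code δ) → Code (b ∷ δ)

-- level + cardinality − 1 + overline of the last block
height : ∀ {δ} → Code δ → ℕ
height ε                = 0
height (new {b} c t χ)  = height c + bit b + t + bit χ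
height (mrg _ c)        = suc (height c)

weight : ∀ {δ} → Code δ → ℕ
weight ε               = 0
weight (new {b} c t χ) = height c + bit b + t + weight c
weight (mrg _ c)       = weight c

plains : ∀ {δ} → Code δ → ℕ
plains ε           = 0
plains (new c t χ) = bit (not χ) + plains c
plains (mrg _ c)   = plains c

-- Raising the head at a descent keeps the head 0 free as the mark of a merged letter.
bumpHead : Bool → List ℕ → List ℕ
bumpHead true  (y ∷ τ) = suc y ∷ τ
bumpHead _     τ       = τ

bumpHead-injective : ∀ b {τ τ′} → bumpHead b τ ≡ bumpHead b τ′ → τ ≡ τ′
bumpHead-injective true {[]}    {[]}     eq   = refl
bumpHead-injective true {y ∷ τ} {z ∷ τ′} refl = refl
bumpHead-injective false eq = eq

-- Tells the two ways of adding a letter at a descent apart: a merge puts 0 at the head, a new block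
-- never leaves 0 there.
bumpHead≢0∷ : ∀ τ {τ′} → bumpHead true τ ≢ 0 ∷ τ′
bumpHead≢0∷ []      ()
bumpHead≢0∷ (_ ∷ _) ()

length-bumpHead : ∀ b τ → length (bumpHead b τ) ≡ length τ
length-bumpHead true  []      = refl
length-bumpHead true  (_ ∷ _) = refl
length-bumpHead false []      = refl
length-bumpHead false (_ ∷ _) = refl

-- Each entry counts for one more than its value. The additional 1 stands for the overline of a new
-- block or, after a merge, for the larger cardinality.
reach : List ℕ → ℕ
reach τ = length τ + sum τ

reach-∷ʳ : ∀ τ x → reach (τ ∷ʳ x) ≡ suc (reach τ + x)
reach-∷ʳ τ x rewrite length-++ τ {x ∷ []} | sum-++ τ (x ∷ []) = lemma (length τ) (sum τ) x
  where
  lemma : ∀ p s x → p + 1 + (s + (x + 0)) ≡ suc (p + s + x)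
  lemma = solve-∀

reach-bumpHead : ∀ b τ → 1 ≤ length τ → reach (bumpHead b τ) ≡ reach τ + bit b
reach-bumpHead true  (y ∷ τ) _ = lemma (length τ) y (sum τ)
  where
  lemma : ∀ p y s → suc p + (suc y + s) ≡ suc p + (y + s) + 1
  lemma = solve-∀
reach-bumpHead false (y ∷ τ) _ = sym (+-identityʳ _)

reach-bumpHead≤ : ∀ b τ → reach (bumpHead b τ) ≤ reach τ + bit b
reach-bumpHead≤ true  []      = z≤n
reach-bumpHead≤ false []      = z≤n
reach-bumpHead≤ b     (y ∷ τ) = ≤-reflexive (reach-bumpHead b (y ∷ τ) (s≤s z≤n))

-- The letter's value is read off the new height, so that it records by how much the new letter exceeds
-- the component of the maximum in height≡⊔ that it is going to realise.
taus : ∀ {δ} → Code δ → List ℕ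
sigs : ∀ {δ} → Code δ → List ℕ
taus ε                   = []
taus (new {b} c t false) = bumpHead b (taus c)
taus (new {b} c t true)  = bumpHead b (taus c ∷ʳ (height c + t ∸ reach (taus c)))
taus (mrg _ c)           = 0 ∷ taus c
sigs ε                       = []
sigs (new {b} {δ} c t false) = (height c + t ∸ (sum (sigs c) + descents δ)) ∷ sigs c
sigs (new c t true)          = sigs c
sigs (mrg _ c)               = sigs c

length-∷ʳ : ∀ (τ : List ℕ) x → length (τ ∷ʳ x) ≡ suc (length τ)
length-∷ʳ τ x = trans (length-++ τ) (+-comm (length τ) 1)

length-sigs : ∀ {δ} (c : Code δ) → length (sigs c) ≡ plains c
length-sigs ε               = refl
length-sigs (new c t false) = cong suc (length-sigs c)
length-sigs (new c t true)  = length-sigs c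
length-sigs (mrg _ c)       = length-sigs c

length-taus+sigs : ∀ {δ} (c : Code δ) → length (taus c) + length (sigs c) ≡ length δ
length-taus+sigs ε = refl
length-taus+sigs (new {b} c t false)
  rewrite length-bumpHead b (taus c) | +-suc (length (taus c)) (length (sigs c))
  = cong suc (length-taus+sigs c)
length-taus+sigs (new {b} c t true)
  rewrite length-bumpHead b (taus c ∷ʳ (height c + t ∸ reach (taus c)))
        | length-∷ʳ (taus c) (height c + t ∸ reach (taus c))
  = cong suc (length-taus+sigs c)
length-taus+sigs (mrg _ c) = cong suc (length-taus+sigs c)

-- The invariant of the insertion. A new non-overlined block makes the first component equal to the
-- new height, an overlined one the second, and the other component grows by at most `bit b`; a
-- merge raises both by one. The signature comes early because the bounds below apply the invariant
-- to the shorter code.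
height≡⊔ : ∀ {δ} (c : Code δ) → height c ≡ (sum (sigs c) + descents δ) ⊔ reach (taus c)

sigs≤height : ∀ {δ} (c : Code δ) → sum (sigs c) + descents δ ≤ height c
sigs≤height {δ} c = subst (sum (sigs c) + descents δ ≤_) (sym (height≡⊔ c)) (m≤m⊔n _ _)

taus≤height : ∀ {δ} (c : Code δ) → reach (taus c) ≤ height c
taus≤height c = subst (reach (taus c) ≤_) (sym (height≡⊔ c)) (m≤n⊔m _ _)

level-sigs : ∀ {δ} (c : Code δ) t →
  sum (sigs c) + descents δ + (height c + t ∸ (sum (sigs c) + descents δ)) ≡ height c + t
level-sigs c t = m+[n∸m]≡n (m≤n⇒m≤n+o t (sigs≤height c))

level-taus : ∀ {δ} (c : Code δ) t →
  reach (taus c) + (height c + t ∸ reach (taus c)) ≡ height c + t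
level-taus c t = m+[n∸m]≡n (m≤n⇒m≤n+o t (taus≤height c))

height≡⊔ ε = refl
height≡⊔ (new {b} {δ} c t false) = sym (trans (m≥n⇒m⊔n≡m le) eq)
  where
  x = height c + t ∸ (sum (sigs c) + descents δ)
  lemma : ∀ x s d b → x + s + (b + d) ≡ s + d + x + b
  lemma = solve-∀
  lemma₂ : ∀ h t b → h + t + b ≡ h + b + t + 0
  lemma₂ = solve-∀
  eq : x + sum (sigs c) + (bit b + descents δ) ≡ height c + bit b + t + 0
  eq = trans (lemma x (sum (sigs c)) (descents δ) (bit b))
         (trans (cong (_+ bit b) (level-sigs c t)) (lemma₂ (height c) t (bit b)))
  le : reach (bumpHead b (taus c)) ≤ x + sum (sigs c) + (bit b + descents δ)
  le = ≤-trans (reach-bumpHead≤ b (taus c))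
         (subst (reach (taus c) + bit b ≤_) (sym (trans eq (+-identityʳ _)))
           (m≤n⇒m≤n+o t (+-monoˡ-≤ (bit b) (taus≤height c))))
height≡⊔ (new {b} {δ} c t true) = sym (trans (m≤n⇒m⊔n≡n le) eq)
  where
  x = height c + t ∸ reach (taus c)
  lemma₂ : ∀ h t b → suc (h + t) + b ≡ h + b + t + 1
  lemma₂ = solve-∀
  eq : reach (bumpHead b (taus c ∷ʳ x)) ≡ height c + bit b + t + 1
  eq = trans (reach-bumpHead b (taus c ∷ʳ x) (subst (1 ≤_) (sym (length-∷ʳ (taus c) x)) (s≤s z≤n)))
        (trans (cong (_+ bit b) (trans (reach-∷ʳ (taus c) x) (cong suc (level-taus c t))))
          (lemma₂ (height c) t (bit b)))
  le : sum (sigs c) + (bit b + descents δ) ≤ reach (bumpHead b (taus c ∷ʳ x))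
  le = subst (sum (sigs c) + (bit b + descents δ) ≤_) (sym eq)
        (m≤n⇒m≤n+o 1 (m≤n⇒m≤n+o t
          (subst (_≤ height c + bit b) (lemma (sum (sigs c)) (descents δ) (bit b))
            (+-monoˡ-≤ (bit b) (sigs≤height c)))))
    where
    lemma : ∀ s d b → s + d + b ≡ s + (b + d)
    lemma = solve-∀
height≡⊔ (mrg {δ = δ} refl c)
  = trans (cong suc (height≡⊔ c)) (cong (_⊔ suc (reach (taus c))) (sym (+-suc (sum (sigs c)) (descents δ))))

-- Injectivity and surjectivity for a fixed word

private
  -- A non-overlined and an overlined last letter cannot yield the same pair. The first level is a
  -- component of the height of `c₂`, hence at most the second level; the second is strictly below a
  -- component of the height of `c₁`, because an entry of `τ` adds one more than its value to
  -- `reach`.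
  absurd-levels : ∀ {δ} (c₁ c₂ : Code δ) (t₁ t₂ : ℕ) →
    taus c₁ ≡ taus c₂ ∷ʳ (height c₂ + t₂ ∸ reach (taus c₂)) →
    (height c₁ + t₁ ∸ (sum (sigs c₁) + descents δ)) ∷ sigs c₁ ≡ sigs c₂ → ⊥
  absurd-levels {δ} c₁ c₂ t₁ t₂ τeq σeq = <-irrefl refl (begin-strict
    height c₁ + t₁                            ≡⟨ level-sigs c₁ t₁ ⟨
    sum (sigs c₁) + descents δ + x₁           ≡⟨ lemma (sum (sigs c₁)) (descents δ) x₁ ⟩
    x₁ + sum (sigs c₁) + descents δ           ≡⟨ cong (λ σ → sum σ + descents δ) σeq ⟩
    sum (sigs c₂) + descents δ                ≤⟨ sigs≤height c₂ ⟩
    height c₂                                 ≤⟨ m≤m+n _ t₂ ⟩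
    height c₂ + t₂                            ≡⟨ level-taus c₂ t₂ ⟨
    reach (taus c₂) + x₂                      <⟨ n<1+n _ ⟩
    suc (reach (taus c₂) + x₂)                ≡⟨ reach-∷ʳ (taus c₂) x₂ ⟨
    reach (taus c₂ ∷ʳ x₂)                     ≡⟨ cong reach τeq ⟨
    reach (taus c₁)                           ≤⟨ taus≤height c₁ ⟩
    height c₁                                 ≤⟨ m≤m+n _ t₁ ⟩
    height c₁ + t₁ ∎)
    where
    open ≤-Reasoning
    x₁ = height c₁ + t₁ ∸ (sum (sigs c₁) + descents δ)
    x₂ = height c₂ + t₂ ∸ reach (taus c₂)
    lemma : ∀ s d x → s + d + x ≡ x + s + d
    lemma = solve-∀

≡true-irrelevant : ∀ {b} (p q : b ≡ true) → p ≡ q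
≡true-irrelevant refl refl = refl

-- The head 0 at a descent detects merges and `absurd-levels` settles the overline. The shorter code
-- then follows by induction, and `t` by cancelling the height in the level of the new block.
taus,sigs-injective : ∀ {δ} (c c′ : Code δ) → taus c ≡ taus c′ → sigs c ≡ sigs c′ → c ≡ c′
taus,sigs-injective ε ε _ _ = refl
taus,sigs-injective (mrg p c) (mrg q c′) τeq σeq
  with refl ← ≡true-irrelevant p q
  with refl ← taus,sigs-injective c c′ (proj₂ (∷-injective τeq)) σeq = refl
taus,sigs-injective (mrg refl c) (new c′ t false) τeq _ = ⊥-elim (bumpHead≢0∷ (taus c′) (sym τeq))
taus,sigs-injective (mrg refl c) (new c′ t true)  τeq _ = ⊥-elim (bumpHead≢0∷ (taus c′ ∷ʳ _) (sym τeq))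
taus,sigs-injective (new c t false) (mrg refl c′) τeq _ = ⊥-elim (bumpHead≢0∷ (taus c) τeq)
taus,sigs-injective (new c t true)  (mrg refl c′) τeq _ = ⊥-elim (bumpHead≢0∷ (taus c ∷ʳ _) τeq)
taus,sigs-injective (new {b} c t false) (new c′ t′ true) τeq σeq
  = ⊥-elim (absurd-levels c c′ t t′ (bumpHead-injective b τeq) σeq)
taus,sigs-injective (new {b} c t true) (new c′ t′ false) τeq σeq
  = ⊥-elim (absurd-levels c′ c t′ t (bumpHead-injective b (sym τeq)) (sym σeq))
taus,sigs-injective (new {b} {δ} c t false) (new c′ t′ false) τeq σeq
  with refl ← taus,sigs-injective c c′ (bumpHead-injective b τeq) (proj₂ (∷-injective σeq))
  with refl ← +-cancelˡ-≡ (height c) t t′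
    (trans (sym (level-sigs c t)) (trans (cong (sum (sigs c) + descents δ +_) (proj₁ (∷-injective σeq))) (level-sigs c t′)))
  = refl
taus,sigs-injective (new {b} c t true) (new c′ t′ true) τeq σeq
  with refl ← taus,sigs-injective c c′ (proj₁ (∷ʳ-injective (taus c) (taus c′) (bumpHead-injective b τeq))) σeq
  with refl ← +-cancelˡ-≡ (height c) t t′
    (trans (sym (level-taus c t)) (trans (cong (reach (taus c) +_) (proj₂ (∷ʳ-injective (taus c) (taus c) (bumpHead-injective b τeq)))) (level-taus c t′)))
  = refl

HasCode : List Bool → List ℕ → List ℕ → Set
HasCode δ τ σ = Σ (Code δ) λ c → taus c ≡ τ × sigs c ≡ σ

private
  -- The level prescribed by `x` dominates both components of the height of the shorter code. By the
  -- invariant it is at least that height, and the excess is the `t` of the new letter.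
  add-plain : ∀ {b δ τ x σ} → HasCode δ τ σ → reach τ ≤ x + sum σ + descents δ →
    HasCode (b ∷ δ) (bumpHead b τ) (x ∷ σ)
  add-plain {b} {δ} {x = x} (c , refl , refl) le
    = new c (s ∸ height c) false , refl
    , cong (_∷ sigs c) (trans (cong (_∸ d) (m+[n∸m]≡n h≤s)) (trans (cong (_∸ d) s≡) (m+n∸m≡n d x)))
    where
    s = x + sum (sigs c) + descents δ
    d = sum (sigs c) + descents δ
    s≡ : s ≡ d + x
    s≡ = lemma x (sum (sigs c)) (descents δ)
      where
      lemma : ∀ x s d → x + s + d ≡ s + d + x
      lemma = solve-∀
    h≤s : height c ≤ s
    h≤s = subst (_≤ s) (sym (height≡⊔ c)) (⊔-lub (subst (d ≤_) (sym s≡) (m≤m+n d x)) le)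

  add-over : ∀ {b δ τ x σ} → HasCode δ τ σ → sum σ + descents δ ≤ reach τ + x →
    HasCode (b ∷ δ) (bumpHead b (τ ∷ʳ x)) σ
  add-over {b} {x = x} (c , refl , refl) le
    = new c (s ∸ height c) true
    , cong (λ y → bumpHead b (taus c ∷ʳ y)) (trans (cong (_∸ reach (taus c)) (m+[n∸m]≡n h≤s)) (m+n∸m≡n (reach (taus c)) x))
    , refl
    where
    s = reach (taus c) + x
    h≤s : height c ≤ s
    h≤s = subst (_≤ s) (sym (height≡⊔ c)) (⊔-lub le (m≤m+n _ x))

-- Letters are removed one at a time: at a descent a head 0 is a merge and a positive head is
-- lowered by one, after which `add-letter` decides about the overline. The two functions are
-- mutually recursive.
taus,sigs-surjective : ∀ δ τ σ → length τ + length σ ≡ length δ → HasCode δ τ σ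

private
  -- The comparison of the two components tells which of them the last letter realised: the first,
  -- by the head of `σ`, or the second, by the last entry of `τ`.
  add-letter : ∀ b δ τ σ → length τ + length σ ≡ suc (length δ) → HasCode (b ∷ δ) (bumpHead b τ) σ
  add-letter b δ τ σ eq with reach τ ≤? sum σ + descents δ
  add-letter b δ τ (x ∷ σ) eq | yes le
    = add-plain (taus,sigs-surjective δ τ σ (suc-injective (trans (sym (+-suc _ _)) eq))) le
  -- With `σ` empty, `τ` has one entry more than `δ`; each entry adds at least 1 to `reach`, while
  -- there are at most `length δ` descents.
  add-letter b δ τ [] eq | yes le = ⊥-elim (<-irrefl refl (begin-strict
    length δ        <⟨ n<1+n _ ⟩
    suc (length δ)  ≡⟨ trans (sym (+-identityʳ _)) eq ⟨
    length τ        ≤⟨ m≤m+n _ (sum τ) ⟩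
    reach τ         ≤⟨ le ⟩
    descents δ      ≤⟨ descents≤length δ ⟩
    length δ        ∎))
    where open ≤-Reasoning
  add-letter b δ τ σ eq | no ≰ with initLast τ
  ... | [] = ⊥-elim (≰ z≤n)
  ... | τ₀ ∷ʳ′ x = add-over
    (taus,sigs-surjective δ τ₀ σ (suc-injective (trans (cong (_+ length σ) (sym (length-∷ʳ τ₀ x))) eq)))
    (s≤s⁻¹ (subst (sum σ + descents δ <_) (reach-∷ʳ τ₀ x) (≰⇒> ≰)))

taus,sigs-surjective [] [] [] _ = ε , refl , refl
taus,sigs-surjective (true ∷ δ) (0 ∷ τ) σ eq
  with c , refl , refl ← taus,sigs-surjective δ τ σ (suc-injective eq) = mrg refl c , refl , refl
taus,sigs-surjective (true ∷ δ) (suc y ∷ τ) σ eq = add-letter true δ (y ∷ τ) σ eq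
taus,sigs-surjective (true ∷ δ)  [] σ eq = add-letter true δ [] σ eq
taus,sigs-surjective (false ∷ δ) τ  σ eq = add-letter false δ τ σ eq

-- plainTop is the largest level of the non-overlined parts encoded by σ, plainSum the sum of their levels;
-- total adds the levels of the overlined parts encoded by τ.
plainSum : List Bool → List ℕ → ℕ
plainTop : List Bool → List ℕ → ℕ
plainTop (b ∷ δ) (x ∷ σ) = plainTop δ σ + x + bit b
plainTop _       _       = 0
plainSum (b ∷ δ) (x ∷ σ) = plainTop (b ∷ δ) (x ∷ σ) + plainSum δ σ
plainSum _       _       = 0

total : List Bool → List ℕ → List ℕ → ℕ
total δ       []      σ = plainSum δ σ
total []      (y ∷ τ) σ = 0
-- The increment `y` raises this overlined part and all later ones, whence the factor
-- `suc (length τ)`. If the flag is false, equal levels are forbidden and each later part rises by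
-- one more.
total (b ∷ δ) (y ∷ τ) σ = y * suc (length τ) + bit (not b) * length τ + total δ τ σ

plainTop≡ : ∀ δ σ → length σ ≡ length δ → plainTop δ σ ≡ sum σ + descents δ
plainTop≡ []      []      _  = refl
plainTop≡ (b ∷ δ) (x ∷ σ) eq rewrite plainTop≡ δ σ (suc-injective eq)
  = lemma (sum σ) (descents δ) x (bit b)
  where
  lemma : ∀ s d x b → s + d + x + b ≡ x + s + (b + d)
  lemma = solve-∀

-- The gain is the level of the new block, and `bit b * length τ` is the amount that `bumpHead`
-- supplies. The new letter moves every entry of `τ` to the preceding flag; as
-- `bit (not b) * p + bit b * p` is `p` for either value of `b`, the induction can exchange one flag
-- for the next.
total-plain : ∀ b δ τ x σ → length τ + length σ ≡ length δ →
  total (b ∷ δ) τ (x ∷ σ) + bit b * length τ ≡ x + sum σ + descents (b ∷ δ) + total δ τ σ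
total-plain b δ [] x σ eq rewrite plainTop≡ δ σ eq
  = lemma (sum σ) (descents δ) x (bit b) (plainSum δ σ)
  where
  lemma : ∀ s d x b w → (s + d + x + b) + w + b * 0 ≡ x + s + (b + d) + w
  lemma = solve-∀
total-plain b (b₀ ∷ δ) (y ∷ τ) x σ eq = begin
  y * suc p + bit (not b) * p + X + bit b * suc p
    ≡⟨ l₁ (bit b) (bit (not b)) y p X ⟩
  y * suc p + (bit (not b) * p + bit b * p) + X + bit b
    ≡⟨ cong (λ z → y * suc p + z + X + bit b) (trans (complementary b) (sym (complementary b₀))) ⟩
  y * suc p + (bit (not b₀) * p + bit b₀ * p) + X + bit b
    ≡⟨ l₂ (y * suc p) (bit (not b₀) * p) (bit b₀ * p) X (bit b) ⟩
  y * suc p + bit (not b₀) * p + (X + bit b₀ * p) + bit b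
    ≡⟨ cong (λ z → y * suc p + bit (not b₀) * p + z + bit b) (total-plain b₀ δ τ x σ (suc-injective eq)) ⟩
  y * suc p + bit (not b₀) * p + (x + sum σ + descents (b₀ ∷ δ) + Y) + bit b
    ≡⟨ l₃ (y * suc p) (bit (not b₀) * p) (x + sum σ) (descents (b₀ ∷ δ)) Y (bit b) ⟩
  x + sum σ + (bit b + descents (b₀ ∷ δ)) + (y * suc p + bit (not b₀) * p + Y) ∎
  where
  open ≡-Reasoning
  p = length τ
  X = total (b₀ ∷ δ) τ (x ∷ σ)
  Y = total δ τ σ
  complementary : ∀ b → bit (not b) * p + bit b * p ≡ p
  complementary true  = +-identityʳ p
  complementary false = trans (+-identityʳ _) (+-identityʳ p)
  l₁ : ∀ b b′ y p X → y * suc p + b′ * p + X + b * suc p ≡ y * suc p + (b′ * p + b * p) + X + b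
  l₁ = solve-∀
  l₂ : ∀ y′ c′p cp X b → y′ + (c′p + cp) + X + b ≡ y′ + c′p + (X + cp) + b
  l₂ = solve-∀
  l₃ : ∀ y′ c′p S D Y b → y′ + c′p + (S + D + Y) + b ≡ S + (b + D) + (y′ + c′p + Y)
  l₃ = solve-∀

-- The same exchange of flags, with the new entry at the far end of `τ`, so that it belongs to the
-- largest overlined part; the gain is again the level of the new block, up to `bit b`.
total-over : ∀ b δ τ x σ → length τ + length σ ≡ length δ →
  total (b ∷ δ) (τ ∷ʳ x) σ + bit b * length τ ≡ reach τ + x + total δ τ σ
total-over b δ [] x σ eq = lemma x (bit (not b)) (bit b) (plainSum δ σ)
  where
  lemma : ∀ x b′ b w → x * 1 + b′ * 0 + w + b * 0 ≡ x + w
  lemma = solve-∀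
total-over b (b₀ ∷ δ) (y ∷ τ) x σ eq rewrite length-∷ʳ τ x = begin
    y * suc (suc p) + bit (not b) * suc p + X + bit b * suc p
      ≡⟨ l₁ (bit b) (bit (not b)) y p X ⟩
    y * suc (suc p) + (bit (not b) + bit b) * suc p + X
      ≡⟨ cong (λ z → y * suc (suc p) + z * suc p + X) (one b) ⟩
    y * suc (suc p) + 1 * suc p + X
      ≡⟨ l₄ y p X ⟩
    y * suc p + suc (y + 1 * p) + X
      ≡⟨ cong (λ z → y * suc p + suc (y + z * p) + X) (sym (one b₀)) ⟩
    y * suc p + suc (y + (bit (not b₀) + bit b₀) * p) + X
      ≡⟨ l₂ y p (bit (not b₀)) (bit b₀) X ⟩
    y * suc p + suc (y + bit (not b₀) * p) + (X + bit b₀ * p)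
      ≡⟨ cong (λ z → y * suc p + suc (y + bit (not b₀) * p) + z) IH ⟩
    y * suc p + suc (y + bit (not b₀) * p) + (p + sum τ + x + Y)
      ≡⟨ l₃ (y * suc p) (bit (not b₀) * p) p y (sum τ) x Y ⟩
    suc (p + (y + sum τ) + x + (y * suc p + bit (not b₀) * p + Y)) ∎
  where
  open ≡-Reasoning
  p = length τ
  X = total (b₀ ∷ δ) (τ ∷ʳ x) σ
  Y = total δ τ σ
  one : ∀ b → bit (not b) + bit b ≡ 1
  one true  = refl
  one false = refl
  IH : X + bit b₀ * p ≡ reach τ + x + Y
  IH = total-over b₀ δ τ x σ (suc-injective eq)
  l₁ : ∀ b b′ y p X → y * suc (suc p) + b′ * suc p + X + b * suc p ≡ y * suc (suc p) + (b′ + b) * suc p + X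
  l₁ = solve-∀
  l₄ : ∀ y p X → y * suc (suc p) + 1 * suc p + X ≡ y * suc p + suc (y + 1 * p) + X
  l₄ = solve-∀
  l₂ : ∀ y p c′ c X → y * suc p + suc (y + (c′ + c) * p) + X ≡ y * suc p + suc (y + c′ * p) + (X + c * p)
  l₂ = solve-∀
  l₃ : ∀ y′ c p y s x Y → y′ + suc (y + c) + (p + s + x + Y) ≡ suc (p + (y + s) + x + (y′ + c + Y))
  l₃ = solve-∀

total-bumpHead : ∀ b b′ δ τ σ → total (b′ ∷ δ) (bumpHead b τ) σ ≡ total (b′ ∷ δ) τ σ + bit b * length τ
total-bumpHead true  b′ δ []      σ = sym (+-identityʳ _)
total-bumpHead false b′ δ []      σ = sym (+-identityʳ _)
total-bumpHead false b′ δ (y ∷ τ) σ = sym (+-identityʳ _)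
total-bumpHead true  b′ δ (y ∷ τ) σ = lemma y (length τ) (bit (not b′)) (total δ τ σ)
  where
  lemma : ∀ y p c w → suc y * suc p + c * p + w ≡ y * suc p + c * p + w + 1 * suc p
  lemma = solve-∀

weight≡total : ∀ {δ} (c : Code δ) → weight c ≡ total δ (taus c) (sigs c)
weight≡total ε = refl
-- An entry 0 at a descent contributes nothing to `total`, so both sides reduce to those of `c`.
weight≡total (mrg refl c) = weight≡total c
weight≡total (new {b} {δ} c t false) = sym (begin
  total (b ∷ δ) (bumpHead b (taus c)) (x ∷ sigs c)
    ≡⟨ total-bumpHead b b δ (taus c) (x ∷ sigs c) ⟩
  total (b ∷ δ) (taus c) (x ∷ sigs c) + bit b * length (taus c)
    ≡⟨ total-plain b δ (taus c) x (sigs c) (length-taus+sigs c) ⟩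
  x + sum (sigs c) + (bit b + descents δ) + total δ (taus c) (sigs c)
    ≡⟨ cong₂ _+_ (lemma x (sum (sigs c)) (bit b) (descents δ)) (sym (weight≡total c)) ⟩
  sum (sigs c) + descents δ + x + bit b + weight c
    ≡⟨ cong (λ z → z + bit b + weight c) (level-sigs c t) ⟩
  height c + t + bit b + weight c
    ≡⟨ cong (_+ weight c) (lemma₂ (height c) t (bit b)) ⟩
  height c + bit b + t + weight c ∎)
  where
  open ≡-Reasoning
  x = height c + t ∸ (sum (sigs c) + descents δ)
  lemma : ∀ x s b d → x + s + (b + d) ≡ s + d + x + b
  lemma = solve-∀
  lemma₂ : ∀ h t b → h + t + b ≡ h + b + t
  lemma₂ = solve-∀
weight≡total (new {b} {δ} c t true) = sym (begin
  total (b ∷ δ) (bumpHead b (taus c ∷ʳ x)) (sigs c)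
    ≡⟨ total-bumpHead b b δ (taus c ∷ʳ x) (sigs c) ⟩
  total (b ∷ δ) (taus c ∷ʳ x) (sigs c) + bit b * length (taus c ∷ʳ x)
    ≡⟨ cong (λ z → total (b ∷ δ) (taus c ∷ʳ x) (sigs c) + bit b * z) (length-∷ʳ (taus c) x) ⟩
  total (b ∷ δ) (taus c ∷ʳ x) (sigs c) + bit b * suc (length (taus c))
    ≡⟨ lemma (total (b ∷ δ) (taus c ∷ʳ x) (sigs c)) (bit b) (length (taus c)) ⟩
  total (b ∷ δ) (taus c ∷ʳ x) (sigs c) + bit b * length (taus c) + bit b
    ≡⟨ cong (_+ bit b) (total-over b δ (taus c) x (sigs c) (length-taus+sigs c)) ⟩
  reach (taus c) + x + total δ (taus c) (sigs c) + bit b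
    ≡⟨ cong₂ (λ y z → y + z + bit b) (level-taus c t) (sym (weight≡total c)) ⟩
  height c + t + weight c + bit b
    ≡⟨ lemma₂ (height c) t (bit b) (weight c) ⟩
  height c + bit b + t + weight c ∎)
  where
  open ≡-Reasoning
  x = height c + t ∸ reach (taus c)
  lemma : ∀ X b p → X + b * suc p ≡ X + b * p + b
  lemma = solve-∀
  lemma₂ : ∀ h t b w → h + t + w + b ≡ h + b + t + w
  lemma₂ = solve-∀

-- Subset sums of a superincreasing sequence

Ascending : ∀ {r} → List (Fin r) → Set
Ascending = AllPairs Fin._<_

indices : ∀ {r} → Subset r → List (Fin r)
indices []          = []
indices (true ∷ S)  = zero ∷ map suc (indices S)
indices (false ∷ S) = map suc (indices S)

selected≡map-indices : ∀ {r} (a : Fin r → ℕ) S → selected a S ≡ map a (indices S)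
selected≡map-indices a []          = refl
selected≡map-indices a (true ∷ S)  = cong (a zero ∷_) (trans (selected≡map-indices (a ∘ suc) S) (map-∘ (indices S)))
selected≡map-indices a (false ∷ S) = trans (selected≡map-indices (a ∘ suc) S) (map-∘ (indices S))

subsetSum≤take : ∀ {r} (a : Fin r → ℕ) S k → All (λ i → toℕ i < k) (indices S) →
  subsetSum a S ≤ sum (take k (tabulate a))
subsetSum≤take a []          k _ = z≤n
subsetSum≤take a (true ∷ S)  (suc k) (_ ∷ <k)
  = +-monoʳ-≤ (a zero) (subsetSum≤take (a ∘ suc) S k (All.map s≤s⁻¹ (All.map⁻ <k)))
subsetSum≤take a (false ∷ S) (suc k) <k
  = m≤n⇒m≤o+n (a zero) (subsetSum≤take (a ∘ suc) S k (All.map s≤s⁻¹ (All.map⁻ <k)))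
subsetSum≤take a (false ∷ S) zero <0 with indices S | selected≡map-indices (a ∘ suc) S | <0
... | []    | eq | _      = ≤-reflexive (cong sum eq)
... | _ ∷ _ | _  | () ∷ _

subsetSum≤total : ∀ {r} (a : Fin r → ℕ) S → subsetSum a S ≤ sum (tabulate a)
subsetSum≤total a []          = z≤n
subsetSum≤total a (true ∷ S)  = +-monoʳ-≤ (a zero) (subsetSum≤total (a ∘ suc) S)
subsetSum≤total a (false ∷ S) = m≤n⇒m≤o+n (a zero) (subsetSum≤total (a ∘ suc) S)

private
  positive⇒map-suc : ∀ {r} (is : List (Fin (suc r))) → All (λ i → 0 < toℕ i) is → ∃ λ js → is ≡ map suc js
  positive⇒map-suc [] [] = [] , refl
  positive⇒map-suc (suc i ∷ is) (_ ∷ ps) with js , refl ← positive⇒map-suc is ps = i ∷ js , refl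

  ascending-map-suc⁻ : ∀ {r} {is : List (Fin r)} → Ascending (map suc is) → Ascending is
  ascending-map-suc⁻ = AllPairs.map s≤s⁻¹ ∘ AllPairs.map⁻

-- Transfers the hypotheses, which speak of subsets, to ascending lists of colours, the form in
-- which blocks are built.
ascending⇒indices : ∀ {r} (is : List (Fin r)) → Ascending is → ∃ λ S → indices S ≡ is
ascending⇒indices {zero}  [] _ = [] , refl
ascending⇒indices {suc r} [] _ with S , eq ← ascending⇒indices {r} [] [] = false ∷ S , cong (map suc) eq
ascending⇒indices {suc r} (zero ∷ is) (ps ∷ asc)
  with js , refl ← positive⇒map-suc is ps
  with S , eq ← ascending⇒indices js (ascending-map-suc⁻ asc)
  = true ∷ S , cong ((zero ∷_) ∘ map suc) eq
ascending⇒indices {suc r} (suc i ∷ is) asc@(ps ∷ _)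
  with js , refl ← positive⇒map-suc is (All.map (≤-trans (s≤s z≤n)) ps)
  with S , eq ← ascending⇒indices (i ∷ js) (ascending-map-suc⁻ asc)
  = false ∷ S , cong (map suc) eq

indices-ascending : ∀ {r} (S : Subset r) → Ascending (indices S)
indices-ascending []          = []
indices-ascending (true ∷ S)  = All.map⁺ (All.universal (λ _ → s≤s z≤n) (indices S)) ∷ AllPairs.map⁺ (AllPairs.map s≤s (indices-ascending S))
indices-ascending (false ∷ S) = AllPairs.map⁺ (AllPairs.map s≤s (indices-ascending S))

indices-nonempty : ∀ {r} (S : Subset r) {i is} → indices S ≡ i ∷ is → Nonempty S
indices-nonempty (true ∷ S)  _  = zero , here
indices-nonempty (false ∷ S) eq with indices S in eqS
... | j ∷ js with k , k∈S ← indices-nonempty S eqS = suc k , there k∈S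

nonempty⇒nonemptyᵇ : ∀ {r} (S : Subset r) → Nonempty S → T (nonemptyᵇ S)
nonempty⇒nonemptyᵇ (true ∷ S)  _                   = _
nonempty⇒nonemptyᵇ (false ∷ S) (suc i , there i∈S) = nonempty⇒nonemptyᵇ S (i , i∈S)

nonemptyᵇ⇒indices : ∀ {r} (S : Subset r) → T (nonemptyᵇ S) → ∃₂ λ i is → indices S ≡ i ∷ is
nonemptyᵇ⇒indices (true ∷ S)  _ = _ , _ , refl
nonemptyᵇ⇒indices (false ∷ S) t with i , is , eq ← nonemptyᵇ⇒indices S t = _ , _ , cong (map suc) eq

∈-allSubsets : ∀ {r} (S : Subset r) → S ∈ allSubsets r
∈-allSubsets []                = here refl
∈-allSubsets (true ∷ S)        = ∈-++⁺ˡ (∈-map⁺ (true ∷_) (∈-allSubsets S))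
∈-allSubsets {suc r} (false ∷ S) = ∈-++⁺ʳ (map (true ∷_) (allSubsets r)) (∈-map⁺ (false ∷_) (∈-allSubsets S))

findᵇ-total : ∀ {A : Set} (p : A → Bool) {x} xs → x ∈ xs → T (p x) → ∃ λ y → findᵇ p xs ≡ just y × T (p y)
findᵇ-total p (y ∷ xs) x∈ px with p y in eq
... | true  = y , refl , Equivalence.from T-≡ eq
... | false with x∈
...   | here refl with () ← subst T eq px
...   | there x∈xs = findᵇ-total p xs x∈xs px

minL-ascending : ∀ x xs → All (x ≤_) xs → minL (x ∷ xs) ≡ x
minL-ascending x [] [] = refl
minL-ascending x (y ∷ xs) (x≤y ∷ ps) rewrite minL-ascending x xs ps = m≥n⇒m⊓n≡n x≤y

sumOf : ∀ {r} → (Fin r → ℕ) → List (Fin r) → ℕ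
sumOf a B = sum (map a B)

record Superincreasing {r : ℕ} (a : Fin r → ℕ) (N : ℕ) : Set where
  field
    superincreasing : ∀ k → sum (take (toℕ k) (tabulate a)) < a k
    distinct-sums   : ∀ S T → Nonempty S → Nonempty T → subsetSum a S ≡ subsetSum a T → S ≡ T
    total≤N         : sum (tabulate a) ≤ N

module Alphabet {r : ℕ} (a : Fin r → ℕ) (N : ℕ) (hyp : Superincreasing a N) where
  open Superincreasing hyp

  -- The sum is bounded by the prefix sum before `k`. At equal levels, a block with all colours
  -- below `k` is therefore smaller than the single colour `k`.
  sumOf<a : ∀ B k → Ascending B → All (Fin._< k) B → sumOf a B < a k
  sumOf<a B k asc B<k with S , refl ← ascending⇒indices B asc
    = ≤-<-trans (subst (_≤ sum (take (toℕ k) (tabulate a))) (cong sum (selected≡map-indices a S))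
        (subsetSum≤take a S (toℕ k) B<k)) (superincreasing k)

  sumOf≤N : ∀ B → Ascending B → sumOf a B ≤ N
  sumOf≤N B asc with S , refl ← ascending⇒indices B asc
    = ≤-trans (subst (_≤ sum (tabulate a)) (cong sum (selected≡map-indices a S)) (subsetSum≤total a S)) total≤N

  a>0 : ∀ k → 0 < a k
  a>0 k = ≤-<-trans z≤n (superincreasing k)

  a-mono-< : ∀ {i j} → i Fin.< j → a i < a j
  a-mono-< {i} {j} i<j = subst (_< a j) (+-identityʳ _) (sumOf<a (i ∷ []) j ([] ∷ []) (i<j ∷ []))

  a-mono-≤ : ∀ {i j} → i Fin.≤ j → a i ≤ a j
  a-mono-≤ {i} {j} i≤j with m≤n⇒m<n∨m≡n i≤j
  ... | inj₁ i<j = <⇒≤ (a-mono-< i<j)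
  ... | inj₂ eq  rewrite toℕ-injective eq = ≤-refl

  a≤N : ∀ k → a k ≤ N
  a≤N k = subst (_≤ N) (+-identityʳ _) (sumOf≤N (k ∷ []) ([] ∷ []))

  subsetSum≡sumOf : ∀ S {B} → indices S ≡ B → subsetSum a S ≡ sumOf a B
  subsetSum≡sumOf S refl = cong sum (selected≡map-indices a S)

  sumOf-injective : ∀ {i B j B′} → Ascending (i ∷ B) → Ascending (j ∷ B′) →
    sumOf a (i ∷ B) ≡ sumOf a (j ∷ B′) → i ∷ B ≡ j ∷ B′
  sumOf-injective {i} {B} {j} {B′} asc asc′ eq
    with S , Seq ← ascending⇒indices (i ∷ B) asc
    with S′ , S′eq ← ascending⇒indices (j ∷ B′) asc′
    with refl ← distinct-sums S S′ (indices-nonempty S Seq) (indices-nonempty S′ S′eq)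
                  (trans (subsetSum≡sumOf S Seq) (trans eq (sym (subsetSum≡sumOf S′ S′eq))))
    = trans (sym Seq) S′eq

  a-injective : ∀ {i j} → a i ≡ a j → i ≡ j
  a-injective {i} {j} eq = ∷-injectiveˡ (sumOf-injective ([] ∷ []) ([] ∷ []) (cong (_+ 0) eq))

  -- The search succeeds because the wanted subset is in the list, and distinctness of the sums
  -- forces whatever it finds to be that subset.
  subsetOf≡ : ∀ i B → Ascending (i ∷ B) → ∃ λ S → subsetOf a (sumOf a (i ∷ B)) ≡ just S × selected a S ≡ map a (i ∷ B)
  subsetOf≡ i B asc
    with S , Seq ← ascending⇒indices (i ∷ B) asc
    with S′ , found , ok ← findᵇ-total (λ S → nonemptyᵇ S ∧ (subsetSum a S ≡ᵇ sumOf a (i ∷ B))) (allSubsets r)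
           (∈-allSubsets S)
           (Equivalence.from T-∧ (nonempty⇒nonemptyᵇ S (indices-nonempty S Seq)
                                 , ≡⇒≡ᵇ (subsetSum a S) _ (subsetSum≡sumOf S Seq)))
    with ne , eq ← Equivalence.to (T-∧ {nonemptyᵇ S′}) ok
    with _ , _ , S′eq ← nonemptyᵇ⇒indices S′ ne
    with refl ← distinct-sums S S′ (indices-nonempty S Seq) (indices-nonempty S′ S′eq)
                  (trans (subsetSum≡sumOf S Seq) (sym (≡ᵇ⇒≡ _ _ eq)))
    = S , found , trans (selected≡map-indices a S) (cong (map a) Seq)

  w≡length : ∀ i B → Ascending (i ∷ B) → w a (sumOf a (i ∷ B)) ≡ suc (length B)
  w≡length i B asc with S , found , sel ← subsetOf≡ i B asc rewrite found | sel = cong suc (length-map a B)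

  v≡a : ∀ i B → Ascending (i ∷ B) → v a (sumOf a (i ∷ B)) ≡ a i
  v≡a i B (ps ∷ asc) with S , found , sel ← subsetOf≡ i B (ps ∷ asc) rewrite found | sel
    = minL-ascending (a i) (map a B) (All.map⁺ (All.map (λ p → <⇒≤ (a-mono-< p)) ps))

  -- Used with `α` in `{1,…,N}`, the range of `β`; in this range level and residue are determined by
  -- the size.
  size : ℕ → ℕ → ℕ
  size m α = m * N + α

  size-injective : ∀ m m′ {α α′} → 0 < α → α ≤ N → 0 < α′ → α′ ≤ N → size m α ≡ size m′ α′ → m ≡ m′ × α ≡ α′
  size-injective zero    zero     _ _ _ _ eq = refl , eq
  size-injective zero    (suc m′) {α} {α′} α>0 α≤N α′>0 α′≤N eq = ⊥-elim (<-irrefl eq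
    (≤-<-trans α≤N (<-≤-trans (m<m+n N α′>0) (+-monoˡ-≤ α′ (m≤m+n N (m′ * N))))))
  size-injective (suc m) zero     {α} {α′} α>0 α≤N α′>0 α′≤N eq = ⊥-elim (<-irrefl (sym eq)
    (≤-<-trans α′≤N (<-≤-trans (m<m+n N α>0) (+-monoˡ-≤ α (m≤m+n N (m * N))))))
  size-injective (suc m) (suc m′) {α} {α′} α>0 α≤N α′>0 α′≤N eq
    with refl , eq′ ← size-injective m m′ α>0 α≤N α′>0 α′≤N
           (+-cancelˡ-≡ N _ _ (trans (sym (+-assoc N (m * N) α)) (trans eq (+-assoc N (m′ * N) α′))))
    = refl , eq′

  size-mono-< : ∀ {m m′ α α′} → m < m′ → α ≤ N → 0 < α′ → size m α < size m′ α′
  size-mono-< {m} {m′} {α} {α′} m<m′ α≤N α′>0 = begin-strict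
    m * N + α   ≤⟨ +-monoʳ-≤ (m * N) α≤N ⟩
    m * N + N   ≡⟨ +-comm (m * N) N ⟩
    suc m * N   ≤⟨ *-monoˡ-≤ N m<m′ ⟩
    m′ * N      <⟨ m<m+n (m′ * N) α′>0 ⟩
    m′ * N + α′ ∎
    where open ≤-Reasoning

  mod-size : 0 < N → ∀ m α → (size m α) mod N ≡ α mod N
  mod-size N>0 m α = go N N>0
    where
    go : ∀ N → 0 < N → (m * N + α) mod N ≡ α mod N
    go (suc N) _ = trans (cong (_% suc N) (+-comm (m * suc N) α)) ([m+kn]%n≡m%n α m (suc N))

  mod-decompose : 0 < N → ∀ x α → 0 < x → 0 < α → α ≤ N → x mod N ≡ α mod N → ∃ λ m → x ≡ size m α
  mod-decompose N>0 x α = go N N>0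
    where
    go : ∀ N → 0 < N → 0 < x → 0 < α → α ≤ N → x mod N ≡ α mod N → ∃ λ m → x ≡ m * N + α
    go (suc N) _ x>0 α>0 α≤N eq with m≤n⇒m<n∨m≡n α≤N
    ... | inj₁ α<N = x / suc N , trans (m≡m%n+[m/n]*n x (suc N)) (trans (+-comm (x % suc N) _)
                       (cong (x / suc N * suc N +_) (trans eq (m<n⇒m%n≡m α<N))))
    -- For `α = N` the remainder is 0, so one multiple of `N` is taken out of the quotient; quotient
    -- 0 would make `x` zero.
    ... | inj₂ refl with x / suc N | m≡m%n+[m/n]*n x (suc N)
    ...   | zero  | x≡ = ⊥-elim (<-irrefl (sym (trans x≡ (trans (+-identityʳ _) (trans eq (n%n≡0 (suc N)))))) x>0)
    ...   | suc m | x≡ = m , trans x≡ (trans (cong (_+ suc m * suc N) (trans eq (n%n≡0 (suc N)))) (+-comm (suc N) _))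

  β-size : 0 < N → ∀ m α → 0 < α → α ≤ N → β N (size m α) ≡ α
  β-size N>0 m (suc α) _ α≤N = cong suc (go N N>0 α≤N)
    where
    go : ∀ N → 0 < N → α < N → ((m * N + suc α) ∸ 1) mod N ≡ α
    go (suc N) _ α<N = trans (cong (λ z → (z ∸ 1) % suc N) (+-suc (m * suc N) α))
      (trans (cong (_% suc N) (+-comm (m * suc N) α))
      (trans ([m+kn]%n≡m%n α m (suc N)) (m<n⇒m%n≡m α<N)))

-- Counting overpartitions by enumeration

-- Pigeonhole by deletion: the partner of the first element is cut out of `ys`, and injectivity
-- ensures that no later element has the same partner.
length-injection : ∀ {A B : Set} (R : A → B → Set) → (∀ {x x′ y} → R x y → R x′ y → x ≡ x′) →
  ∀ xs ys → Unique xs → (∀ {x} → x ∈ xs → ∃ λ y → y ∈ ys × R x y) → length xs ≤ length ys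
length-injection R inj [] ys _ _ = z≤n
length-injection R inj (x ∷ xs) ys (x∉xs ∷ uniq) total with total (here refl)
... | y , y∈ys , Rxy with ys₁ , ys₂ , refl ← ∈-∃++ y∈ys = subst (suc (length xs) ≤_)
        (trans (cong suc (length-++ ys₁)) (trans (sym (+-suc (length ys₁) (length ys₂))) (sym (length-++ ys₁))))
        (s≤s (length-injection R inj xs (ys₁ ++ ys₂) uniq total′))
  where
  total′ : ∀ {z} → z ∈ xs → ∃ λ y′ → y′ ∈ ys₁ ++ ys₂ × R z y′
  total′ z∈xs with total (there z∈xs)
  ... | y′ , y′∈ , Rzy′ with ∈-++⁻ ys₁ y′∈
  ...   | inj₁ y′∈₁         = y′ , ∈-++⁺ˡ y′∈₁ , Rzy′
  ...   | inj₂ (there y′∈₂) = y′ , ∈-++⁺ʳ ys₁ y′∈₂ , Rzy′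
  ...   | inj₂ (here refl)  = ⊥-elim (All.lookup x∉xs z∈xs (inj Rxy Rzy′))

length-filter-bijection : ∀ {A : Set} (R : A → A → Set) (P Q : A → Bool) xs → Unique xs →
  (∀ {x x′ y} → R x y → R x′ y → x ≡ x′) → (∀ {x y y′} → R x y → R x y′ → y ≡ y′) →
  (∀ x → T (P x) → ∃ λ y → y ∈ xs × T (Q y) × R x y) →
  (∀ y → T (Q y) → ∃ λ x → x ∈ xs × T (P x) × R x y) →
  length (filterᵇ P xs) ≡ length (filterᵇ Q xs)
length-filter-bijection R P Q xs uniq inj fun to from = ≤-antisym
  (length-injection R inj _ _ (Unique.filter⁺ (λ x → T? (P x)) uniq)
    (λ {x} x∈ → let y , y∈ , Qy , Rxy = to x (proj₂ (∈-filter⁻ (λ x → T? (P x)) {xs = xs} x∈))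
                in y , ∈-filter⁺ (λ x → T? (Q x)) y∈ Qy , Rxy))
  (length-injection (λ y x → R x y) fun _ _ (Unique.filter⁺ (λ x → T? (Q x)) uniq)
    (λ {y} y∈ → let x , x∈ , Px , Rxy = from y (proj₂ (∈-filter⁻ (λ x → T? (Q x)) {xs = xs} y∈))
                in x , ∈-filter⁺ (λ x → T? (P x)) x∈ Px , Rxy))

concatMap-unique : ∀ {A B : Set} (f : A → List B) xs → Unique xs → (∀ x → Unique (f x)) →
  (∀ {x x′ y} → y ∈ f x → y ∈ f x′ → x ≡ x′) → Unique (concatMap f xs)
concatMap-unique f xs uniq uniqf inj = Unique.concat⁺
  (All.map⁺ (All.universal uniqf xs))
  (AllPairs.map⁺ (AllPairs.map (λ x≢x′ {_} (y∈ , y∈′) → x≢x′ (inj y∈ y∈′)) uniq))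

partChoices-unique : ∀ n → Unique (partChoices n)
partChoices-unique n = concatMap-unique _ (upTo n) (Unique.upTo⁺ n)
  (λ x → ((λ ()) ∷ []) ∷ [] ∷ []) disjoint
  where
  disjoint : ∀ {x x′ p} → p ∈ (suc x , true) ∷ (suc x , false) ∷ [] →
    p ∈ (suc x′ , true) ∷ (suc x′ , false) ∷ [] → x ≡ x′
  disjoint (here refl)         (here refl)         = refl
  disjoint (there (here refl)) (there (here refl)) = refl
  disjoint (here refl)         (there (here ()))
  disjoint (there (here refl)) (here ())

seqs-unique : ∀ n l → Unique (seqs n l)
seqs-unique n zero    = [] ∷ []
seqs-unique n (suc l) = All.tabulate (λ { {[]} []∈ refl → []∉ []∈ })
  ∷ concatMap-unique _ (partChoices n) (partChoices-unique n)
      (λ p → Unique.map⁺ (λ eq → proj₂ (∷-injective eq)) (seqs-unique n l))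
      (λ {p} {p′} y∈ y∈′ → case-heads (∈-map⁻ (p ∷_) y∈) (∈-map⁻ (p′ ∷_) y∈′))
  where
  case-heads : ∀ {p p′ : Part} {y : OP} → ∃ (λ z → z ∈ seqs n l × y ≡ p ∷ z) → ∃ (λ z → z ∈ seqs n l × y ≡ p′ ∷ z) → p ≡ p′
  case-heads (_ , _ , refl) (_ , _ , refl) = refl
  []∉ : [] ∈ concatMap (λ p → map (p ∷_) (seqs n l)) (partChoices n) → ⊥
  []∉ []∈ with xs , []∈xs , xs∈ ← ∈-concat⁻′ (map (λ p → map (p ∷_) (seqs n l)) (partChoices n)) []∈
    with p , _ , refl ← ∈-map⁻ (λ p → map (p ∷_) (seqs n l)) xs∈
    with _ , _ , () ← ∈-map⁻ (p ∷_) []∈xs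

∈-partChoices : ∀ n x b → 0 < x → x ≤ n → (x , b) ∈ partChoices n
∈-partChoices n (suc x) b _ x<n = ∈-concat⁺′ {vs = (suc x , true) ∷ (suc x , false) ∷ []} (mem b)
  (∈-map⁺ (λ x → (suc x , true) ∷ (suc x , false) ∷ []) (∈-upTo⁺ x<n))
  where
  mem : ∀ b → (suc x , b) ∈ (suc x , true) ∷ (suc x , false) ∷ []
  mem true  = here refl
  mem false = there (here refl)

∈-seqs : ∀ n l (xs : OP) → length xs ≤ l → All (λ p → 0 < proj₁ p × proj₁ p ≤ n) xs → xs ∈ seqs n l
∈-seqs n zero    []             _ _ = here refl
∈-seqs n (suc l) []             _ _ = here refl
∈-seqs n (suc l) ((x , b) ∷ xs) (s≤s le) ((x>0 , x≤n) ∷ ps) = there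
  (∈-concat⁺′ (∈-map⁺ ((x , b) ∷_) (∈-seqs n l xs le ps))
    (∈-map⁺ (λ p → map (p ∷_) (seqs n l)) (∈-partChoices n x b x>0 x≤n)))

length≤sum : ∀ (xs : OP) → All (λ p → 0 < proj₁ p) xs → length xs ≤ sum (map proj₁ xs)
length≤sum [] [] = z≤n
length≤sum (x ∷ xs) (p ∷ ps) = +-mono-≤ p (length≤sum xs ps)

parts≤sum : ∀ (xs : OP) → All (λ p → proj₁ p ≤ sum (map proj₁ xs)) xs
parts≤sum []       = []
parts≤sum (x ∷ xs) = m≤m+n (proj₁ x) _ ∷ All.map (λ le → m≤n⇒m≤o+n (proj₁ x) le) (parts≤sum xs)

∈-candidates : ∀ n (xs : OP) → All (λ p → 0 < proj₁ p) xs → sum (map proj₁ xs) ≡ n → xs ∈ candidates n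
∈-candidates n xs ps refl = ∈-seqs n n xs (length≤sum xs ps) (All.zip (ps , parts≤sum xs))

-- Overpartitions with merged parts

-- Words are stored last letter first, so `u` begins with the predecessor of `v`. A letter without
-- predecessor is no descent.
flag : ∀ {r} → Fin r → List (Fin r) → Bool
flag v []      = false
flag v (u ∷ _) = toℕ v <ᵇ toℕ u

flags : ∀ {r} → List (Fin r) → List Bool
flags []      = []
flags (v ∷ u) = flag v u ∷ flags u

length-flags : ∀ {r} (u : List (Fin r)) → length (flags u) ≡ length u
length-flags []      = refl
length-flags (v ∷ u) = cong suc (length-flags u)

<ᵇ≡true⇒< : ∀ m n → (m <ᵇ n) ≡ true → m < n
<ᵇ≡true⇒< m n eq = <ᵇ⇒< m n (Equivalence.from T-≡ eq)

<⇒<ᵇ≡true : ∀ {m n} → m < n → (m <ᵇ n) ≡ true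
<⇒<ᵇ≡true lt = Equivalence.to T-≡ (<⇒<ᵇ lt)

<ᵇ≡false⇒≥ : ∀ m n → (m <ᵇ n) ≡ false → n ≤ m
<ᵇ≡false⇒≥ m n eq = ≮⇒≥ (λ lt → case-absurd (trans (sym eq) (<⇒<ᵇ≡true lt)))
  where
  case-absurd : false ≡ true → ⊥
  case-absurd ()

sumSizes : OP → ℕ
sumSizes l = sum (map proj₁ l)

bump : ℕ → OP → OP
bump y []            = []
bump y ((x , χ) ∷ l) = (x + y , χ) ∷ l

nonOverlined-∷ : ∀ x χ (l : OP) → nonOverlined ((x , χ) ∷ l) ≡ bit (not χ) + nonOverlined l
nonOverlined-∷ x true  l = refl
nonOverlined-∷ x false l = refl

nonOverlined-bump : ∀ y l → nonOverlined (bump y l) ≡ nonOverlined l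
nonOverlined-bump y []                = refl
nonOverlined-bump y ((x , true)  ∷ l) = refl
nonOverlined-bump y ((x , false) ∷ l) = refl

module Merged {r : ℕ} (a : Fin r → ℕ) (N : ℕ) (hyp : Superincreasing a N) where
  open Alphabet a N hyp

  -- The largest part comes first in an OP, matching the last letter first convention for words;
  -- merging the colour v into the top part adds a v to its size.
  encE : (u : List (Fin r)) → Code (flags u) → OP
  encE []      ε           = []
  encE (v ∷ u) (new c t χ) = (size (height c + bit (flag v u) + t) (a v) , χ) ∷ encE u c
  encE (v ∷ u) (mrg _ c)   = bump (a v) (encE u c)

  -- Witnesses membership in `A′_N`. The ascending list of colours is the subset with the given sum,
  -- so `w` is one more than the length of `others` and `v` is `a lead`.
  record Block (x : ℕ) : Set where
    field
      level     : ℕ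
      lead      : Fin r
      others    : List (Fin r)
      ascending : Ascending (lead ∷ others)
      size≡     : x ≡ size level (sumOf a (lead ∷ others))

  sumOf>0 : ∀ i B → 0 < sumOf a (i ∷ B)
  sumOf>0 i B = m≤n⇒m≤n+o _ (a>0 i)

  blockSize-injective : ∀ m m′ {i B j B′} → Ascending (i ∷ B) → Ascending (j ∷ B′) →
    size m (sumOf a (i ∷ B)) ≡ size m′ (sumOf a (j ∷ B′)) → m ≡ m′ × i ∷ B ≡ j ∷ B′
  blockSize-injective m m′ {i} {B} {j} {B′} asc asc′ eq
    with refl , eq′ ← size-injective m m′ (sumOf>0 i B) (sumOf≤N _ asc) (sumOf>0 j B′) (sumOf≤N _ asc′) eq
    = refl , sumOf-injective asc asc′ eq′

  -- The first part of an encoded list determines the height of the code, and its smallest colour is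
  -- the last letter of the word.
  record Top (v : Fin r) (h : ℕ) (l : OP) : Set where
    field
      level     : ℕ
      others    : List (Fin r)
      overlined : Bool
      rest      : OP
      ascending : Ascending (v ∷ others)
      list≡     : l ≡ (size level (sumOf a (v ∷ others)) , overlined) ∷ rest
      height≡   : h ≡ level + length others + bit overlined

  size-merge : ∀ m i s → size m s + a i ≡ size m (a i + s)
  size-merge m i s = lemma (m * N) s (a i)
    where
    lemma : ∀ x s y → x + s + y ≡ x + (y + s)
    lemma = solve-∀

  singleton : ∀ m i → size m (a i) ≡ size m (sumOf a (i ∷ []))
  singleton m i = cong (size m) (sym (+-identityʳ (a i)))

  flag-true : ∀ (v k : Fin r) u → flag v (k ∷ u) ≡ true → v Fin.< k
  flag-true v k u = <ᵇ≡true⇒< (toℕ v) (toℕ k)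

  extend : ∀ {v k : Fin r} {B} → v Fin.< k → Ascending (k ∷ B) → Ascending (v ∷ k ∷ B)
  extend v<k (ps ∷ asc) = (v<k ∷ All.map (<-trans v<k) ps) ∷ ps ∷ asc

  top : ∀ v u (c : Code (flags (v ∷ u))) → Top v (height c) (encE (v ∷ u) c)
  top v u (new c t χ) = record
    { level     = height c + bit (flag v u) + t
    ; ascending = [] ∷ []
    ; list≡     = cong (λ x → (x , χ) ∷ encE u c) (singleton (height c + bit (flag v u) + t) v)
    ; height≡   = cong (_+ bit χ) (sym (+-identityʳ _)) }
  top v (k ∷ u) (mrg p c) = record
    { level     = level
    ; others    = k ∷ others
    ; overlined = overlined
    ; rest      = rest
    ; ascending = extend (flag-true v k u p) ascending
    ; list≡     = trans (cong (bump (a v)) list≡) (cong (λ x → (x , overlined) ∷ rest) (size-merge level v _))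
    ; height≡   = trans (cong suc height≡) (cong (_+ bit overlined) (sym (+-suc level (length others)))) }
    where
    T₀ : Top k (height c) (encE (k ∷ u) c)
    T₀ = top k u c
    open Top {k} {height c} {encE (k ∷ u) c} T₀

  -- The gap condition after adding the smaller part to both sides: its residue cancels, and what
  -- remains involves no subtraction.
  Gap : ℕ → Part → Set
  Gap x (y , χ) = Σ (Block y) λ B → let open Block B in size (level + length others + bit χ) (a lead) ≤ x

  data Spaced : OP → Set where
    nil  : Spaced []
    one  : ∀ {x χ} → Block x → Spaced ((x , χ) ∷ [])
    cons : ∀ {x χ q l} → Block x → Gap x q → Spaced (q ∷ l) → Spaced ((x , χ) ∷ q ∷ l)

  -- At a descent the additional level outweighs the smaller colour; otherwise the colour does not
  -- decrease and level `h` suffices.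
  size-threshold : ∀ h v k u t → size h (a k) ≤ size (h + bit (flag v (k ∷ u)) + t) (a v)
  size-threshold h v k u t with toℕ v <ᵇ toℕ k in eq
  ... | true  = <⇒≤ (size-mono-< (m≤n⇒m≤n+o t (≤-reflexive (+-comm 1 h))) (a≤N k) (a>0 v))
  ... | false = +-mono-≤ (*-monoˡ-≤ N (m≤n⇒m≤n+o t (m≤m+n h 0))) (a-mono-≤ (<ᵇ≡false⇒≥ (toℕ v) (toℕ k) eq))

  singletonBlock : ∀ m v → Block (size m (a v))
  singletonBlock m v = record { level = m ; lead = v ; others = [] ; ascending = [] ∷ [] ; size≡ = singleton m v }

  encE-spaced : ∀ u c → Spaced (encE u c)
  encE-spaced [] ε = nil
  encE-spaced (v ∷ []) (new ε t χ) = one (singletonBlock t v)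
  encE-spaced (v ∷ k ∷ u) (new {b} c t χ) = subst (λ l → Spaced ((x , χ) ∷ l)) (sym list≡)
    (cons (singletonBlock (height c + bit b + t) v)
          (record { level = level ; ascending = ascending ; size≡ = refl }
          , subst (λ h → size h (a k) ≤ x) height≡ (size-threshold (height c) v k u t))
          (subst Spaced list≡ (encE-spaced (k ∷ u) c)))
    where
    T₀ : Top k (height c) (encE (k ∷ u) c)
    T₀ = top k u c
    open Top {k} {height c} {encE (k ∷ u) c} T₀
    x = size (height c + bit b + t) (a v)
  encE-spaced (v ∷ k ∷ u) (mrg p c) = subst (Spaced ∘ bump (a v)) (sym list≡)
    (enlarge (subst Spaced list≡ (encE-spaced (k ∷ u) c)))
    where
    T₀ : Top k (height c) (encE (k ∷ u) c)
    T₀ = top k u c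
    open Top {k} {height c} {encE (k ∷ u) c} T₀
    merged : Block (size level (sumOf a (k ∷ others)) + a v)
    merged = record { level = level ; ascending = extend (flag-true v k u p) ascending ; size≡ = size-merge level v _ }
    -- A merge enlarges the first part alone, so its gap to the second persists.
    enlarge : ∀ {χ l} → Spaced ((size level (sumOf a (k ∷ others)) , χ) ∷ l) →
      Spaced (bump (a v) ((size level (sumOf a (k ∷ others)) , χ) ∷ l))
    enlarge (one _)               = one merged
    enlarge (cons _ (B , gap) sp) = cons merged (B , m≤n⇒m≤n+o (a v) gap) sp

  -- The flag of the largest colour of a block. This letter comes directly after `u` in the word and
  -- starts the block.
  flagLast : Fin r → List (Fin r) → List (Fin r) → Bool
  flagLast i []      u = flag i u
  flagLast i (j ∷ B) u = flagLast j B u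

  flagLast-true : ∀ i B k u → Ascending (i ∷ B) → flagLast i B (k ∷ u) ≡ true → All (Fin._< k) (i ∷ B)
  flagLast-true i []      k u _ eq = flag-true i k u eq ∷ []
  flagLast-true i (j ∷ B) k u ((i<j ∷ _) ∷ asc) eq with flagLast-true j B k u asc eq
  ... | j<k ∷ ps = <-trans i<j j<k ∷ j<k ∷ ps

  -- Converse of `size-threshold` for whole blocks. A level below `h` makes the block too small. At
  -- a descent all colours of the block are below `k`, so level `h` itself is excluded by `sumOf<a`.
  level-threshold : ∀ h m i B k u → Ascending (i ∷ B) → size h (a k) ≤ size m (sumOf a (i ∷ B)) →
    h + bit (flagLast i B (k ∷ u)) ≤ m
  level-threshold h m i B k u asc le = by-flag (flagLast i B (k ∷ u)) refl
    where
    h≤m : h ≤ m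
    h≤m = ≮⇒≥ (λ m<h → <⇒≱ (size-mono-< m<h (sumOf≤N _ asc) (a>0 k)) le)
    by-flag : ∀ b → flagLast i B (k ∷ u) ≡ b → h + bit b ≤ m
    by-flag false _  = subst (_≤ m) (sym (+-identityʳ h)) h≤m
    by-flag true  eq = subst (_≤ m) (+-comm 1 h) (≤∧≢⇒< h≤m (λ { refl →
      <⇒≱ (+-monoʳ-< (h * N) (sumOf<a _ k asc (flagLast-true i B k u asc eq))) le }))

  -- The largest colour starts the block at level `m`; the smaller ones are then merged in
  -- decreasing order, each at a descent.
  append : ∀ i B → Ascending (i ∷ B) → ∀ u (c : Code (flags u)) m χ → height c + bit (flagLast i B u) ≤ m →
    ∃ λ c′ → encE (i ∷ B ++ u) c′ ≡ (size m (sumOf a (i ∷ B)) , χ) ∷ encE u c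
  append i [] _ u c m χ le = new c (m ∸ (height c + bit (flag i u))) χ
    , cong (λ x → (x , χ) ∷ encE u c) (trans (cong (λ s → size s (a i)) (m+[n∸m]≡n le)) (singleton m i))
  append i (j ∷ B) ((i<j ∷ _) ∷ asc) u c m χ le with c′ , eq ← append j B asc u c m χ le
    = mrg (<⇒<ᵇ≡true i<j) c′
    , trans (cong (bump (a i)) eq) (cong (λ x → (x , χ) ∷ encE u c) (size-merge m i _))

  -- Blocks are added from the smallest part upwards. Since a size determines its level and colours,
  -- the block in the gap condition is the top block of the code found so far, and the bound becomes
  -- the height of that code.
  encE-surjective : ∀ {l} → Spaced l → ∃₂ λ u c → encE u c ≡ l
  encE-surjective nil = [] , ε , refl
  encE-surjective (one {χ = χ} B)
    = let c , eq = append lead others ascending [] ε level χ (zero-flag lead others)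
      in _ , c , trans eq (cong (λ x → (x , χ) ∷ []) (sym size≡))
    where
    open Block B
    zero-flag : ∀ i B → bit (flagLast i B []) ≤ level
    zero-flag i []      = z≤n
    zero-flag i (j ∷ B) = zero-flag j B
  encE-surjective (cons {x = x} {χ = χ} {q = y , χ′} B (B′ , gap) sp) with encE-surjective sp
  ... | [] , ε , ()
  ... | k ∷ u , c , eq
    = let c′ , eq′ = append lead others ascending (k ∷ u) c level χ
                       (level-threshold (height c) level lead others k u ascending gap′)
      in _ , c′ , trans eq′ (cong₂ _∷_ (cong (_, χ) (sym size≡)) eq)
    where
    open Block B
    T₀ : Top k (height c) (encE (k ∷ u) c)
    T₀ = top k u c
    module T = Top T₀
    module B′ = Block B′
    head≡ : (size T.level (sumOf a (k ∷ T.others)) , T.overlined) ≡ (y , χ′)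
    head≡ = ∷-injectiveˡ (trans (sym T.list≡) eq)
    same : T.level ≡ B′.level × k ∷ T.others ≡ B′.lead ∷ B′.others
    same = blockSize-injective T.level B′.level T.ascending B′.ascending (trans (cong proj₁ head≡) B′.size≡)
    threshold≡ : size (height c) (a k) ≡ size (B′.level + length B′.others + bit χ′) (a B′.lead)
    threshold≡ = cong₂ (λ h i → size h (a i))
      (trans T.height≡ (cong₂ _+_ (cong₂ _+_ (proj₁ same) (cong length (∷-injectiveʳ (proj₂ same)))) (cong bit (cong proj₂ head≡))))
      (∷-injectiveˡ (proj₂ same))
    gap′ : size (height c) (a k) ≤ size level (sumOf a (lead ∷ others))
    gap′ = subst₂ _≤_ (sym threshold≡) size≡ gap

  Word : Set
  Word = Σ (List (Fin r)) λ u → Code (flags u)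

  -- The first part has a single colour on one side and at least two on the other.
  new≢mrg : ∀ v u (c : Code (flags u)) t χ v′ k u′ p (c′ : Code (flags (k ∷ u′))) →
    encE (v ∷ u) (new c t χ) ≢ encE (v′ ∷ k ∷ u′) (mrg p c′)
  new≢mrg v u c t χ v′ k u′ p c′ eq
    with () ← proj₂ (blockSize-injective (height c + bit (flag v u) + t) (Top.level (top v′ (k ∷ u′) (mrg p c′))) ([] ∷ [])
           (Top.ascending (top v′ (k ∷ u′) (mrg p c′)))
           (trans (sym (singleton (height c + bit (flag v u) + t) v)) (cong proj₁ (∷-injectiveˡ (trans eq (Top.list≡ (top v′ (k ∷ u′) (mrg p c′))))))))

  encE-injective : ∀ u c u′ c′ → encE u c ≡ encE u′ c′ → _≡_ {A = Word} (u , c) (u′ , c′)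
  encE-injective [] ε [] ε _ = refl
  encE-injective [] ε (v ∷ u) c eq with () ← trans eq (Top.list≡ (top v u c))
  encE-injective (v ∷ u) c [] ε eq with () ← trans (sym eq) (Top.list≡ (top v u c))
  encE-injective (v ∷ u) (new c t χ) (v′ ∷ u′) (new c′ t′ χ′) eq
    with refl ← encE-injective u c u′ c′ (∷-injectiveʳ eq)
    with refl ← cong proj₂ (∷-injectiveˡ eq)
    with level≡ , a≡ ← size-injective (height c + bit (flag v u) + t) (height c′ + bit (flag v′ u′) + t′) (a>0 v) (a≤N v) (a>0 v′) (a≤N v′) (cong proj₁ (∷-injectiveˡ eq))
    with refl ← a-injective a≡
    with refl ← +-cancelˡ-≡ (height c + bit (flag v u)) t t′ level≡
    = refl
  encE-injective (v ∷ u) (new c t χ) (v′ ∷ k ∷ u′) (mrg p c′) eq = ⊥-elim (new≢mrg v u c t χ v′ k u′ p c′ eq)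
  encE-injective (v′ ∷ k ∷ u′) (mrg p c′) (v ∷ u) (new c t χ) eq = ⊥-elim (new≢mrg v u c t χ v′ k u′ p c′ (sym eq))
  encE-injective (v ∷ k ∷ u) (mrg p c) (v′ ∷ k′ ∷ u′) (mrg p′ c′) eq = conclude
    where
    T₁ = top v (k ∷ u) (mrg p c)
    T₂ = top v′ (k′ ∷ u′) (mrg p′ c′)
    S₁₀ : Top k (height c) (encE (k ∷ u) c)
    S₁₀ = top k u c
    module S₁ = Top S₁₀
    S₂₀ : Top k′ (height c′) (encE (k′ ∷ u′) c′)
    S₂₀ = top k′ u′ c′
    module S₂ = Top S₂₀
    lists≡ : (size S₁.level (sumOf a (v ∷ k ∷ S₁.others)) , S₁.overlined) ∷ S₁.rest
           ≡ (size S₂.level (sumOf a (v′ ∷ k′ ∷ S₂.others)) , S₂.overlined) ∷ S₂.rest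
    lists≡ = trans (sym (Top.list≡ T₁)) (trans eq (Top.list≡ T₂))
    same : S₁.level ≡ S₂.level × v ∷ k ∷ S₁.others ≡ v′ ∷ k′ ∷ S₂.others
    same = blockSize-injective S₁.level S₂.level (Top.ascending T₁) (Top.ascending T₂) (cong proj₁ (∷-injectiveˡ lists≡))
    -- Taking the smallest colour out of the equal first parts leaves equal lists.
    smaller≡ : encE (k ∷ u) c ≡ encE (k′ ∷ u′) c′
    smaller≡ = trans S₁.list≡ (trans
      (cong₂ _∷_ (cong₂ _,_ (cong₂ (λ m B → size m (sumOf a B)) (proj₁ same) (∷-injectiveʳ (proj₂ same))) (cong proj₂ (∷-injectiveˡ lists≡)))
                 (∷-injectiveʳ lists≡))
      (sym S₂.list≡))
    conclude : _≡_ {A = Word} (v ∷ k ∷ u , mrg p c) (v′ ∷ k′ ∷ u′ , mrg p′ c′)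
    conclude with refl ← encE-injective (k ∷ u) c (k′ ∷ u′) c′ smaller≡
      with refl ← ∷-injectiveˡ (proj₂ same)
      with refl ← ≡true-irrelevant p p′ = refl

  bump-sum : ∀ y x χ l → sumSizes (bump y ((x , χ) ∷ l)) ≡ y + sumSizes ((x , χ) ∷ l)
  bump-sum y x χ l = lemma y x (sumSizes l)
    where
    lemma : ∀ y x s → x + y + s ≡ y + (x + s)
    lemma = solve-∀

  encE-sum : ∀ u c → sumSizes (encE u c) ≡ size (weight c) (sumOf a u)
  encE-sum [] ε = refl
  encE-sum (v ∷ u) (new {b} c t χ) rewrite encE-sum u c
    = lemma (height c + bit (flag v u) + t) N (a v) (weight c) (sumOf a u)
    where
    lemma : ∀ s n x w y → s * n + x + (w * n + y) ≡ (s + w) * n + (x + y)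
    lemma = solve-∀
  encE-sum (v ∷ k ∷ u) (mrg p c) = begin
    sumSizes (bump (a v) (encE (k ∷ u) c))           ≡⟨ cong (λ l → sumSizes (bump (a v) l)) T.list≡ ⟩
    sumSizes (bump (a v) ((_ , T.overlined) ∷ T.rest)) ≡⟨ bump-sum (a v) _ T.overlined T.rest ⟩
    a v + sumSizes ((_ , T.overlined) ∷ T.rest)        ≡⟨ cong (λ l → a v + sumSizes l) T.list≡ ⟨
    a v + sumSizes (encE (k ∷ u) c)                    ≡⟨ cong (a v +_) (encE-sum (k ∷ u) c) ⟩
    a v + size (weight c) (sumOf a (k ∷ u))            ≡⟨ lemma (a v) (weight c * N) (sumOf a (k ∷ u)) ⟩
    size (weight c) (a v + sumOf a (k ∷ u)) ∎
    where
    open ≡-Reasoning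
    T₀ : Top k (height c) (encE (k ∷ u) c)
    T₀ = top k u c
    module T = Top T₀
    lemma : ∀ x y z → x + (y + z) ≡ y + (x + z)
    lemma = solve-∀

  encE-plains : ∀ u c → nonOverlined (encE u c) ≡ plains c
  encE-plains [] ε = refl
  encE-plains (v ∷ u) (new {b} c t χ) = trans (nonOverlined-∷ (size (height c + bit (flag v u) + t) (a v)) χ (encE u c))
    (cong (bit (not χ) +_) (encE-plains u c))
  encE-plains (v ∷ u) (mrg p c) = trans (nonOverlined-bump (a v) (encE u c)) (encE-plains u c)

-- Overpartitions as merges of their overlined and non-overlined parts

overSizes : OP → List ℕ
overSizes []                = []
overSizes ((x , true)  ∷ l) = x ∷ overSizes l
overSizes ((x , false) ∷ l) = overSizes l

plainSizes : OP → List ℕ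
plainSizes []                = []
plainSizes ((x , true)  ∷ l) = plainSizes l
plainSizes ((x , false) ∷ l) = x ∷ plainSizes l

infix 4 _≽_
_≽_ : Part → Part → Set
(x , b) ≽ (y , c) = y < x ⊎ (x ≡ y × c ≡ false)

≽-trans : ∀ {p q s} → p ≽ q → q ≽ s → p ≽ s
≽-trans (inj₁ lt)          (inj₁ lt′)          = inj₁ (<-trans lt′ lt)
≽-trans (inj₁ lt)          (inj₂ (refl , _))   = inj₁ lt
≽-trans (inj₂ (refl , _))  (inj₁ lt)           = inj₁ lt
≽-trans (inj₂ (refl , _))  (inj₂ (refl , eq))  = inj₂ (refl , eq)

module _ {P : Part → Set} where

  all-split : ∀ l → All P l → All (λ x → P (x , true)) (overSizes l) × All (λ x → P (x , false)) (plainSizes l)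
  all-split [] [] = [] , []
  all-split ((x , true)  ∷ l) (p ∷ ps) with os , ns ← all-split l ps = p ∷ os , ns
  all-split ((x , false) ∷ l) (p ∷ ps) with os , ns ← all-split l ps = os , p ∷ ns

  all-merge : ∀ l → All (λ x → P (x , true)) (overSizes l) → All (λ x → P (x , false)) (plainSizes l) → All P l
  all-merge [] _ _ = []
  all-merge ((x , true)  ∷ l) (p ∷ os) ns = p ∷ all-merge l os ns
  all-merge ((x , false) ∷ l) os (p ∷ ns) = p ∷ all-merge l os ns

sumSizes-split : ∀ l → sumSizes l ≡ sum (overSizes l) + sum (plainSizes l)
sumSizes-split [] = refl
sumSizes-split ((x , true)  ∷ l) rewrite sumSizes-split l = sym (+-assoc x _ _)
sumSizes-split ((x , false) ∷ l) rewrite sumSizes-split l = lemma x (sum (overSizes l)) (sum (plainSizes l))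
  where
  lemma : ∀ x y z → x + (y + z) ≡ y + (x + z)
  lemma = solve-∀

nonOverlined-split : ∀ l → nonOverlined l ≡ length (plainSizes l)
nonOverlined-split [] = refl
nonOverlined-split ((x , true)  ∷ l) = nonOverlined-split l
nonOverlined-split ((x , false) ∷ l) = cong suc (nonOverlined-split l)

overSizes-decreasing : ∀ {l} → AllPairs _≽_ l → AllPairs _>_ (overSizes l)
overSizes-decreasing [] = []
overSizes-decreasing {(x , true)  ∷ l} (ps ∷ sorted)
  = All.map (λ { (inj₁ lt) → lt }) (proj₁ (all-split l ps)) ∷ overSizes-decreasing sorted
overSizes-decreasing {(x , false) ∷ l} (ps ∷ sorted) = overSizes-decreasing sorted

plainSizes-decreasing : ∀ {l} → AllPairs _≽_ l → AllPairs _≥_ (plainSizes l)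
plainSizes-decreasing [] = []
plainSizes-decreasing {(x , false) ∷ l} (ps ∷ sorted)
  = All.map (λ { (inj₁ lt) → <⇒≤ lt ; (inj₂ (refl , _)) → ≤-refl }) (proj₂ (all-split l ps)) ∷ plainSizes-decreasing sorted
plainSizes-decreasing {(x , true)  ∷ l} (ps ∷ sorted) = plainSizes-decreasing sorted

Merge : List ℕ → List ℕ → OP → Set
Merge xs ys l = AllPairs _≽_ l × overSizes l ≡ xs × plainSizes l ≡ ys

private
  ≥⇒≽plain : ∀ {x b y} → y ≤ x → (x , b) ≽ (y , false)
  ≥⇒≽plain le with m≤n⇒m<n∨m≡n le
  ... | inj₁ lt   = inj₁ lt
  ... | inj₂ refl = inj₂ (refl , refl)

  cons-over : ∀ {x xs ys l} → All (x >_) xs → All (x ≥_) ys → Merge xs ys l → Merge (x ∷ xs) ys ((x , true) ∷ l)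
  cons-over {x} {l = l} >xs ≥ys (sorted , refl , refl)
    = all-merge l (All.map inj₁ >xs) (All.map (≥⇒≽plain {x} {true}) ≥ys) ∷ sorted , refl , refl

  cons-plain : ∀ {y xs ys l} → All (y >_) xs → All (y ≥_) ys → Merge xs ys l → Merge xs (y ∷ ys) ((y , false) ∷ l)
  cons-plain {y} {l = l} >xs ≥ys (sorted , refl , refl)
    = all-merge l (All.map inj₁ >xs) (All.map (≥⇒≽plain {y} {false}) ≥ys) ∷ sorted , refl , refl

merge-exists : ∀ xs ys → AllPairs _>_ xs → AllPairs _≥_ ys → ∃ (Merge xs ys)
merge-exists [] [] _ _ = [] , [] , refl , refl
merge-exists [] (y ∷ ys) [] (≥ys ∷ ysd) with l , m ← merge-exists [] ys [] ysd = _ , cons-plain [] ≥ys m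
merge-exists (x ∷ xs) [] (>xs ∷ xsd) [] with l , m ← merge-exists xs [] xsd [] = _ , cons-over >xs [] m
merge-exists (x ∷ xs) (y ∷ ys) (>xs ∷ xsd) (≥ys ∷ ysd)
  = larger-first (merge-exists xs (y ∷ ys) xsd (≥ys ∷ ysd)) (merge-exists (x ∷ xs) ys (>xs ∷ xsd) ysd)
  where
  larger-first : ∃ (Merge xs (y ∷ ys)) → ∃ (Merge (x ∷ xs) ys) → ∃ (Merge (x ∷ xs) (y ∷ ys))
  larger-first (_ , m) (_ , m′) with y ≤? x
  -- On a tie the overlined part goes first, as overpartitions demand.
  ... | yes y≤x = _ , cons-over >xs (y≤x ∷ All.map (λ le → ≤-trans le y≤x) ≥ys) m
  ... | no  y≰x = _ , cons-plain (≰⇒> y≰x ∷ All.map (λ lt → <-trans lt (≰⇒> y≰x)) >xs) ≥ys m′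

private
  -- Each list contains the first part of the other one further on, which would give both `y ≤ x`
  -- and `x < y`.
  over-plain-clash : ∀ {x y : ℕ} {l l′ : OP} → AllPairs _≽_ ((x , true) ∷ l) → AllPairs _≽_ ((y , false) ∷ l′) →
    overSizes ((x , true) ∷ l) ≡ overSizes l′ → plainSizes l ≡ plainSizes ((y , false) ∷ l′) → ⊥
  over-plain-clash {x} {y} {l} {l′} (ps ∷ _) (qs ∷ _) eqo eqp
    with y≤x ∷ _ ← subst (All (λ z → (x , true) ≽ (z , false))) eqp (proj₂ (all-split l ps))
    with x<y ∷ _ ← subst (All (λ z → (y , false) ≽ (z , true))) (sym eqo) (proj₁ (all-split l′ qs))
    = clash y≤x x<y
    where
    clash : (x , true) ≽ (y , false) → (y , false) ≽ (x , true) → ⊥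
    clash (inj₁ lt)         (inj₁ lt′) = <-asym lt lt′
    clash (inj₂ (refl , _)) (inj₁ lt)  = <-irrefl refl lt

merge-unique : ∀ {l l′} → AllPairs _≽_ l → AllPairs _≽_ l′ → overSizes l ≡ overSizes l′ → plainSizes l ≡ plainSizes l′ → l ≡ l′
merge-unique {[]} {[]} _ _ _ _ = refl
merge-unique {[]} {(y , true)  ∷ l′} _ _ () _
merge-unique {[]} {(y , false) ∷ l′} _ _ _ ()
merge-unique {(x , true)  ∷ l} {[]} _ _ () _
merge-unique {(x , false) ∷ l} {[]} _ _ _ ()
merge-unique {(x , true)  ∷ l} {(y , true)  ∷ l′} (_ ∷ s) (_ ∷ s′) eqo eqp
  with refl ← ∷-injectiveˡ eqo | refl ← merge-unique s s′ (∷-injectiveʳ eqo) eqp = refl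
merge-unique {(x , false) ∷ l} {(y , false) ∷ l′} (_ ∷ s) (_ ∷ s′) eqo eqp
  with refl ← ∷-injectiveˡ eqp | refl ← merge-unique s s′ eqo (∷-injectiveʳ eqp) = refl
merge-unique {(x , true)  ∷ l} {(y , false) ∷ l′} s s′ eqo eqp = ⊥-elim (over-plain-clash s s′ eqo eqp)
merge-unique {(x , false) ∷ l} {(y , true)  ∷ l′} s s′ eqo eqp = ⊥-elim (over-plain-clash s′ s (sym eqo) (sym eqp))

all-reverse : ∀ {A : Set} {P : A → Set} {xs} → All P xs → All P (reverse xs)
all-reverse {xs = xs} = All-resp-↭ (↭-sym (↭-reverse xs))

allPairs-reverse : ∀ {A : Set} {R : A → A → Set} {xs} → AllPairs R xs → AllPairs (flip R) (reverse xs)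
allPairs-reverse [] = []
allPairs-reverse {R = R} {x ∷ xs} (ps ∷ rs) = subst (AllPairs (flip R)) (sym (unfold-reverse x xs))
  (AllPairs.++⁺ (allPairs-reverse rs) ([] ∷ []) (All.map (_∷ []) (all-reverse ps)))

-- Overpartitions into parts from `A_N` as words with increments

module Coloured {r : ℕ} (a : Fin r → ℕ) (N : ℕ) (hyp : Superincreasing a N) where
  open Alphabet a N hyp

  Cell : Set
  Cell = ℕ × Fin r

  cellSize : Cell → ℕ
  cellSize (m , v) = size m (a v)

  cellSize-injective : ∀ {p q} → cellSize p ≡ cellSize q → p ≡ q
  cellSize-injective {m , v} {m′ , v′} eq
    with refl , eq′ ← size-injective m m′ (a>0 v) (a≤N v) (a>0 v′) (a≤N v′) eq
    with refl ← a-injective eq′ = refl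

  -- The first |τ| letters of u (stored last letter first) colour the overlined parts, in increasing order;
  -- equal levels are allowed only when the colour increases. The remaining letters colour the
  -- non-overlined parts, in decreasing order.
  overCells : ℕ → List (Fin r) → List ℕ → List Cell
  overCells b u       []      = []
  overCells b []      (y ∷ τ) = []
  overCells b (v ∷ u) (y ∷ τ) = (b + y , v) ∷ overCells (b + y + bit (not (flag v u))) u τ

  plainCells : List (Fin r) → List ℕ → List Cell
  plainCells (v ∷ u) (x ∷ σ) = (plainTop (flags (v ∷ u)) (x ∷ σ) , v) ∷ plainCells u σ
  plainCells _       _       = []

  restCells : List (Fin r) → List ℕ → List ℕ → List Cell
  restCells u       []      σ = plainCells u σ
  restCells []      (y ∷ τ) σ = []
  restCells (v ∷ u) (y ∷ τ) σ = restCells u τ σ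

  levels : List Cell → ℕ
  levels = sum ∘ map proj₁

  levels-plainCells : ∀ u σ → levels (plainCells u σ) ≡ plainSum (flags u) σ
  levels-plainCells []      σ       = refl
  levels-plainCells (v ∷ u) []      = refl
  levels-plainCells (v ∷ u) (x ∷ σ) = cong (plainTop (flags (v ∷ u)) (x ∷ σ) +_) (levels-plainCells u σ)

  levels-cells : ∀ b u τ σ → length τ + length σ ≡ length u →
    levels (overCells b u τ) + levels (restCells u τ σ) ≡ b * length τ + total (flags u) τ σ
  levels-cells b u [] σ eq rewrite levels-plainCells u σ | *-zeroʳ b = refl
  levels-cells b (v ∷ u) (y ∷ τ) σ eq = trans (+-assoc (b + y) _ _)
    (trans (cong (b + y +_) (levels-cells (b + y + bit (not (flag v u))) u τ σ (suc-injective eq)))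
      (lemma b y (bit (not (flag v u))) (length τ) (total (flags u) τ σ)))
    where
    lemma : ∀ b y f p w → b + y + ((b + y + f) * p + w) ≡ b * suc p + (y * suc p + f * p + w)
    lemma = solve-∀

  word-plainCells : ∀ u σ → length σ ≡ length u → map proj₂ (plainCells u σ) ≡ u
  word-plainCells []      []      _  = refl
  word-plainCells (v ∷ u) (x ∷ σ) eq = cong (v ∷_) (word-plainCells u σ (suc-injective eq))

  word-cells : ∀ b u τ σ → length τ + length σ ≡ length u →
    map proj₂ (overCells b u τ) ++ map proj₂ (restCells u τ σ) ≡ u
  word-cells b u       []      σ eq = word-plainCells u σ eq
  word-cells b (v ∷ u) (y ∷ τ) σ eq = cong (v ∷_) (word-cells _ u τ σ (suc-injective eq))

  length-restCells : ∀ u τ σ → length τ + length σ ≡ length u → length (restCells u τ σ) ≡ length σ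
  length-restCells u [] σ eq = trans (sym (length-map proj₂ (plainCells u σ)))
    (trans (cong length (word-plainCells u σ eq)) (sym eq))
  length-restCells (v ∷ u) (y ∷ τ) σ eq = length-restCells u τ σ (suc-injective eq)

  sum-cellSize : ∀ ps → sum (map cellSize ps) ≡ size (levels ps) (sumOf a (map proj₂ ps))
  sum-cellSize [] = refl
  sum-cellSize ((m , v) ∷ ps) rewrite sum-cellSize ps = lemma m N (a v) (levels ps) (sumOf a (map proj₂ ps))
    where
    lemma : ∀ m n x l s → m * n + x + (l * n + s) ≡ (m + l) * n + (x + s)
    lemma = solve-∀

  infix 4 _⋖_
  _⋖_ : Cell → Cell → Set
  p ⋖ q = cellSize p < cellSize q

  infix 4 _⋗_
  -- Weak in spite of the symbol, since non-overlined parts may repeat.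
  _⋗_ : Cell → Cell → Set
  p ⋗ q = cellSize q ≤ cellSize p

  -- Sizes compare by level first and by colour at equal levels. Strict increase therefore costs a
  -- level exactly when the colour does not increase, and for `⋗⁺` weak decrease costs one exactly
  -- when the colour of the smaller cell is larger.
  ⋖⁺ : ∀ {f f′} v v′ → f + bit (not (toℕ v <ᵇ toℕ v′)) ≤ f′ → (f , v) ⋖ (f′ , v′)
  ⋖⁺ {f} {f′} v v′ le with toℕ v <ᵇ toℕ v′ in eq
  ... | true  = +-mono-≤-< (*-monoˡ-≤ N (≤-trans (m≤m+n f 0) le)) (a-mono-< (<ᵇ≡true⇒< (toℕ v) (toℕ v′) eq))
  ... | false = size-mono-< (subst (_≤ f′) (+-comm f 1) le) (a≤N v) (a>0 v′)

  ⋖⁻ : ∀ {f f′} v v′ → (f , v) ⋖ (f′ , v′) → f + bit (not (toℕ v <ᵇ toℕ v′)) ≤ f′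
  ⋖⁻ {f} {f′} v v′ lt = by-flag (toℕ v <ᵇ toℕ v′) refl
    where
    f≤f′ : f ≤ f′
    f≤f′ = ≮⇒≥ (λ f′<f → <-asym lt (size-mono-< f′<f (a≤N v′) (a>0 v)))
    by-flag : ∀ b → (toℕ v <ᵇ toℕ v′) ≡ b → f + bit (not b) ≤ f′
    by-flag true  _  = subst (_≤ f′) (sym (+-identityʳ f)) f≤f′
    by-flag false eq = subst (_≤ f′) (+-comm 1 f) (≤∧≢⇒< f≤f′ (λ { refl →
      <⇒≱ lt (+-monoʳ-≤ (f * N) (a-mono-≤ (<ᵇ≡false⇒≥ (toℕ v) (toℕ v′) eq))) }))

  ⋗⁺ : ∀ {g g′} v v′ → g′ + bit (toℕ v <ᵇ toℕ v′) ≤ g → (g , v) ⋗ (g′ , v′)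
  ⋗⁺ {g} {g′} v v′ le with toℕ v <ᵇ toℕ v′ in eq
  ... | true  = <⇒≤ (size-mono-< (subst (_≤ g) (+-comm g′ 1) le) (a≤N v′) (a>0 v))
  ... | false = +-mono-≤ (*-monoˡ-≤ N (≤-trans (m≤m+n g′ 0) le)) (a-mono-≤ (<ᵇ≡false⇒≥ (toℕ v) (toℕ v′) eq))

  ⋗⁻ : ∀ {g g′} v v′ → (g , v) ⋗ (g′ , v′) → g′ + bit (toℕ v <ᵇ toℕ v′) ≤ g
  ⋗⁻ {g} {g′} v v′ le = by-flag (toℕ v <ᵇ toℕ v′) refl
    where
    g′≤g : g′ ≤ g
    g′≤g = ≮⇒≥ (λ g<g′ → <⇒≱ (size-mono-< g<g′ (a≤N v) (a>0 v′)) le)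
    by-flag : ∀ b → (toℕ v <ᵇ toℕ v′) ≡ b → g′ + bit b ≤ g
    by-flag false _  = subst (_≤ g) (sym (+-identityʳ g′)) g′≤g
    by-flag true  eq = subst (_≤ g) (+-comm 1 g′) (≤∧≢⇒< g′≤g (λ { refl →
      <⇒≱ (+-monoʳ-< (g * N) (a-mono-< (<ᵇ≡true⇒< (toℕ v) (toℕ v′) eq))) le }))

  overCells-increasing : ∀ b u τ → Linked _⋖_ (overCells b u τ)
  overCells-increasing b u       []      = []
  overCells-increasing b []      (y ∷ τ) = []
  overCells-increasing b (v ∷ u) (y ∷ []) = [-]
  overCells-increasing b (v ∷ []) (y ∷ z ∷ τ) = [-]
  overCells-increasing b (v ∷ k ∷ u) (y ∷ z ∷ τ) = ⋖⁺ {b + y} v k (m≤m+n _ z) ∷ overCells-increasing _ (k ∷ u) (z ∷ τ)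

  plainCells-decreasing : ∀ u σ → Linked _⋗_ (plainCells u σ)
  plainCells-decreasing []          σ           = []
  plainCells-decreasing (v ∷ u)     []          = []
  plainCells-decreasing (v ∷ [])    (x ∷ σ)     = [-]
  plainCells-decreasing (v ∷ k ∷ u) (x ∷ [])    = [-]
  plainCells-decreasing (v ∷ k ∷ u) (x ∷ z ∷ σ)
    = ⋗⁺ v k (+-monoˡ-≤ (bit (flag v (k ∷ u))) (m≤m+n (plainTop (flags (k ∷ u)) (z ∷ σ)) x)) ∷ plainCells-decreasing (k ∷ u) (z ∷ σ)

  restCells-decreasing : ∀ u τ σ → Linked _⋗_ (restCells u τ σ)
  restCells-decreasing u       []      σ = plainCells-decreasing u σ
  restCells-decreasing []      (y ∷ τ) σ = []
  restCells-decreasing (v ∷ u) (y ∷ τ) σ = restCells-decreasing u τ σ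

  plainCells-surjective : ∀ ps → Linked _⋗_ ps → ∃ λ σ → length σ ≡ length ps × plainCells (map proj₂ ps) σ ≡ ps
  plainCells-surjective [] _ = [] , refl , refl
  plainCells-surjective ((g , v) ∷ []) _ = g ∷ [] , refl , cong (λ z → (z , v) ∷ []) (+-identityʳ g)
  plainCells-surjective ((g , v) ∷ (g′ , k) ∷ ps) (rel ∷ dec)
    with plainCells-surjective ((g′ , k) ∷ ps) dec
  ... | x ∷ σ , len , eq = (g ∸ (g′ + bit f)) ∷ x ∷ σ , cong suc len , cong₂ (λ z qs → (z , v) ∷ qs) top≡ eq
    where
    f = toℕ v <ᵇ toℕ k
    lemma : ∀ p z b → p + z + b ≡ p + b + z
    lemma = solve-∀
    top≡ : plainTop (flags (k ∷ map proj₂ ps)) (x ∷ σ) + (g ∸ (g′ + bit f)) + bit f ≡ g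
    top≡ = trans (cong (λ p → p + (g ∸ (g′ + bit f)) + bit f) (cong proj₁ (∷-injectiveˡ eq)))
             (trans (lemma g′ (g ∸ (g′ + bit f)) (bit f)) (m+[n∸m]≡n (⋗⁻ {g} {g′} v k rel)))

  From : ℕ → List Cell → Set
  From b []            = ⊤
  From b ((f , _) ∷ _) = b ≤ f

  -- The increments are the excesses over the least admissible levels. The word continues with the
  -- colours `w` of the non-overlined parts; only the flag of the last overlined cell looks into
  -- `w`, and no overlined cell comes after it.
  overCells-surjective : ∀ b ps w → Linked _⋖_ ps → From b ps →
    ∃ λ τ → length τ ≡ length ps × overCells b (map proj₂ ps ++ w) τ ≡ ps
  overCells-surjective b [] w _ _ = [] , refl , refl
  overCells-surjective b ((f , v) ∷ []) w _ le = (f ∸ b) ∷ [] , refl , cong (λ z → (z , v) ∷ []) (m+[n∸m]≡n le)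
  overCells-surjective b ((f , v) ∷ (f′ , k) ∷ ps) w (rel ∷ inc) le
    with τ , len , eq ← overCells-surjective (f + bit (not (toℕ v <ᵇ toℕ k))) ((f′ , k) ∷ ps) w inc (⋖⁻ {f} {f′} v k rel)
    = (f ∸ b) ∷ τ , cong suc len
    , trans (cong (λ z → (z , v) ∷ overCells (z + bit (not (toℕ v <ᵇ toℕ k))) (k ∷ map proj₂ ps ++ w) τ) (m+[n∸m]≡n le))
        (cong ((f , v) ∷_) eq)

  restCells-++ : ∀ w₁ w₂ τ σ → length τ ≡ length w₁ → restCells (w₁ ++ w₂) τ σ ≡ plainCells w₂ σ
  restCells-++ []       w₂ []      σ _  = refl
  restCells-++ (v ∷ w₁) w₂ (y ∷ τ) σ eq = restCells-++ w₁ w₂ τ σ (suc-injective eq)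

  from-zero : ∀ ps → From 0 ps
  from-zero []      = tt
  from-zero (_ ∷ _) = z≤n

  cells-surjective : ∀ ps qs → Linked _⋖_ ps → Linked _⋗_ qs → ∃ λ u → ∃₂ λ τ σ →
    length τ + length σ ≡ length u × overCells 0 u τ ≡ ps × restCells u τ σ ≡ qs
  cells-surjective ps qs inc dec
    with τ , lenτ , eqτ ← overCells-surjective 0 ps (map proj₂ qs) inc (from-zero ps)
    with σ , lenσ , eqσ ← plainCells-surjective qs dec
    = map proj₂ ps ++ map proj₂ qs , τ , σ
    , trans (cong₂ _+_ (trans lenτ (sym (length-map proj₂ ps))) (trans lenσ (sym (length-map proj₂ qs))))
        (sym (length-++ (map proj₂ ps)))
    , eqτ
    , trans (restCells-++ (map proj₂ ps) (map proj₂ qs) τ σ (trans lenτ (sym (length-map proj₂ ps)))) eqσ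

  plainCells-injective : ∀ u σ σ′ → length σ ≡ length u → length σ′ ≡ length u → plainCells u σ ≡ plainCells u σ′ → σ ≡ σ′
  plainCells-injective []      []      []        _ _ _ = refl
  plainCells-injective (v ∷ u) (x ∷ σ) (x′ ∷ σ′) len len′ eq
    with refl ← plainCells-injective u σ σ′ (suc-injective len) (suc-injective len′) (∷-injectiveʳ eq)
    with refl ← +-cancelˡ-≡ (plainTop (flags u) σ) x x′ (+-cancelʳ-≡ (bit (flag v u)) _ _ (cong proj₁ (∷-injectiveˡ eq)))
    = refl

  cells-injective : ∀ b u τ σ τ′ σ′ → length τ + length σ ≡ length u → length τ′ + length σ′ ≡ length u →
    overCells b u τ ≡ overCells b u τ′ → restCells u τ σ ≡ restCells u τ′ σ′ → τ ≡ τ′ × σ ≡ σ′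
  cells-injective b u [] σ [] σ′ len len′ _ eq = refl , plainCells-injective u σ σ′ len len′ eq
  cells-injective b (v ∷ u) [] σ (y ∷ τ′) σ′ len len′ () _
  cells-injective b (v ∷ u) (y ∷ τ) σ [] σ′ len len′ () _
  cells-injective b (v ∷ u) (y ∷ τ) σ (y′ ∷ τ′) σ′ len len′ eqo eqp
    with refl ← +-cancelˡ-≡ b y y′ (cong proj₁ (∷-injectiveˡ eqo))
    with refl , refl ← cells-injective _ u τ σ τ′ σ′ (suc-injective len) (suc-injective len′) (∷-injectiveʳ eqo) eqp
    = refl , refl

  -- The overlined cells increase along the stored word while the parts of an overpartition
  -- decrease, whence the `reverse`.
  record Decodes (u : List (Fin r)) (τ σ : List ℕ) (l : OP) : Set where
    constructor decodes
    field
      sorted : AllPairs _≽_ l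
      over≡  : overSizes l ≡ reverse (map cellSize (overCells 0 u τ))
      plain≡ : plainSizes l ≡ map cellSize (restCells u τ σ)

  decodes-exists : ∀ u τ σ → ∃ (Decodes u τ σ)
  decodes-exists u τ σ with l , s , o , p ← merge-exists
      (reverse (map cellSize (overCells 0 u τ))) (map cellSize (restCells u τ σ))
      (allPairs-reverse (AllPairs.map⁺ (Linked⇒AllPairs <-trans (overCells-increasing 0 u τ))))
      (AllPairs.map⁺ (Linked⇒AllPairs (λ p q → ≤-trans q p) (restCells-decreasing u τ σ)))
    = l , decodes s o p

  decodes-functional : ∀ {u τ σ l l′} → Decodes u τ σ l → Decodes u τ σ l′ → l ≡ l′
  decodes-functional (decodes s o p) (decodes s′ o′ p′) = merge-unique s s′ (trans o (sym o′)) (trans p (sym p′))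

  decodes-injective : ∀ {u τ σ u′ τ′ σ′ l} → length τ + length σ ≡ length u → length τ′ + length σ′ ≡ length u′ →
    Decodes u τ σ l → Decodes u′ τ′ σ′ l → u ≡ u′ × τ ≡ τ′ × σ ≡ σ′
  decodes-injective {u} {τ} {σ} {u′} {τ′} {σ′} len len′ (decodes _ o p) (decodes _ o′ p′) = conclude
    where
    over : overCells 0 u τ ≡ overCells 0 u′ τ′
    over = map-injective cellSize-injective (reverse-injective (trans (sym o) o′))
    plain : restCells u τ σ ≡ restCells u′ τ′ σ′
    plain = map-injective cellSize-injective (trans (sym p) p′)
    conclude : u ≡ u′ × τ ≡ τ′ × σ ≡ σ′
    -- The colours of the cells spell the word; once the words agree, the levels give the
    -- increments.
    conclude with refl ← trans (sym (word-cells 0 u τ σ len))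
        (trans (cong₂ (λ ps qs → map proj₂ ps ++ map proj₂ qs) over plain) (word-cells 0 u′ τ′ σ′ len′))
      = refl , cells-injective 0 u τ σ τ′ σ′ len len′ over plain

  IsCell : ℕ → Set
  IsCell x = ∃ λ p → x ≡ cellSize p

  all-isCell : ∀ xs → All IsCell xs → ∃ λ ps → xs ≡ map cellSize ps
  all-isCell [] [] = [] , refl
  all-isCell (x ∷ xs) ((p , refl) ∷ cs) with ps , refl ← all-isCell xs cs = p ∷ ps , refl

  decodes-surjective : ∀ l → AllPairs _≽_ l → All (IsCell ∘ proj₁) l →
    ∃ λ u → ∃₂ λ τ σ → length τ + length σ ≡ length u × Decodes u τ σ l
  decodes-surjective l sorted cells
    with os , ns ← all-split l cells
    with ps , eqps ← all-isCell (reverse (overSizes l)) (all-reverse os)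
    with qs , eqqs ← all-isCell (plainSizes l) ns
    with u , τ , σ , len , refl , refl ← cells-surjective ps qs
           (AllPairs⇒Linked (AllPairs.map⁻ (subst (AllPairs _<_) eqps (allPairs-reverse (overSizes-decreasing sorted)))))
           (AllPairs⇒Linked (AllPairs.map⁻ (subst (AllPairs _≥_) eqqs (plainSizes-decreasing sorted))))
    = u , τ , σ , len
    , decodes sorted (trans (sym (reverse-involutive (overSizes l))) (cong reverse eqps)) eqqs

  decodes-isCell : ∀ {u τ σ l} → Decodes u τ σ l → All (IsCell ∘ proj₁) l
  decodes-isCell {u} {τ} {σ} {l} (decodes _ o p) = all-merge l
    (subst (All IsCell) (sym o) (all-reverse (cells (overCells 0 u τ))))
    (subst (All IsCell) (sym p) (cells (restCells u τ σ)))
    where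
    cells : ∀ ps → All IsCell (map cellSize ps)
    cells ps = All.map⁺ (All.universal (λ p → p , refl) ps)

  decodes-sum : ∀ {u τ σ l} → length τ + length σ ≡ length u → Decodes u τ σ l →
    sumSizes l ≡ size (total (flags u) τ σ) (sumOf a u)
  decodes-sum {u} {τ} {σ} {l} len (decodes _ o p) = begin
    sumSizes l
      ≡⟨ sumSizes-split l ⟩
    sum (overSizes l) + sum (plainSizes l)
      ≡⟨ cong₂ (λ xs ys → sum xs + sum ys) o p ⟩
    sum (reverse (map cellSize os)) + sum (map cellSize ns)
      ≡⟨ cong₂ _+_ (trans (sum-↭ (↭-reverse (map cellSize os))) (sum-cellSize os)) (sum-cellSize ns) ⟩
    size (levels os) (sumOf a (map proj₂ os)) + size (levels ns) (sumOf a (map proj₂ ns))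
      ≡⟨ lemma (levels os) N (sumOf a (map proj₂ os)) (levels ns) (sumOf a (map proj₂ ns)) ⟩
    size (levels os + levels ns) (sumOf a (map proj₂ os) + sumOf a (map proj₂ ns))
      ≡⟨ cong₂ size (levels-cells 0 u τ σ len) word ⟩
    size (total (flags u) τ σ) (sumOf a u) ∎
    where
    open ≡-Reasoning
    os = overCells 0 u τ
    ns = restCells u τ σ
    lemma : ∀ m n x l s → m * n + x + (l * n + s) ≡ (m + l) * n + (x + s)
    lemma = solve-∀
    word : sumOf a (map proj₂ os) + sumOf a (map proj₂ ns) ≡ sumOf a u
    word = trans (sym (sum-++ (map a (map proj₂ os)) _)) (trans (cong sum (sym (map-++ a (map proj₂ os) _)))
      (cong (sumOf a) (word-cells 0 u τ σ len)))

  decodes-plains : ∀ {u τ σ l} → length τ + length σ ≡ length u → Decodes u τ σ l → nonOverlined l ≡ length σ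
  decodes-plains {u} {τ} {σ} {l} len (decodes _ _ p) = trans (nonOverlined-split l)
    (trans (cong length p) (trans (length-map cellSize (restCells u τ σ)) (length-restCells u τ σ len)))

-- The correspondence

orderedᵇ⇒linked : ∀ l → T (orderedᵇ l) → Linked _≽_ l
orderedᵇ⇒linked [] _ = []
orderedᵇ⇒linked (p ∷ []) _ = [-]
orderedᵇ⇒linked ((x , b) ∷ (y , c) ∷ l) t
  = let h , t′ = Equivalence.to (T-∧ {(y <ᵇ x) ∨ ((x ≡ᵇ y) ∧ not c)}) t in
    step (Equivalence.to (T-∨ {y <ᵇ x}) h) ∷ orderedᵇ⇒linked ((y , c) ∷ l) t′
  where
  plain : ∀ {c} → T (not c) → c ≡ false
  plain {false} _ = refl
  step : T (y <ᵇ x) ⊎ T ((x ≡ᵇ y) ∧ not c) → (x , b) ≽ (y , c)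
  step (inj₁ lt) = inj₁ (<ᵇ⇒< y x lt)
  step (inj₂ e) with e₁ , e₂ ← Equivalence.to (T-∧ {x ≡ᵇ y}) e = inj₂ (≡ᵇ⇒≡ x y e₁ , plain e₂)

linked⇒orderedᵇ : ∀ {l} → Linked _≽_ l → T (orderedᵇ l)
linked⇒orderedᵇ [] = _
linked⇒orderedᵇ [-] = _
linked⇒orderedᵇ (_∷_ {x , b} {y , c} rel rels) = Equivalence.from T-∧ (step rel , linked⇒orderedᵇ rels)
  where
  step : (x , b) ≽ (y , c) → T ((y <ᵇ x) ∨ ((x ≡ᵇ y) ∧ not c))
  step (inj₁ lt)            = Equivalence.from T-∨ (inj₁ (<⇒<ᵇ lt))
  step (inj₂ (refl , refl)) = Equivalence.from (T-∨ {y <ᵇ x}) (inj₂ (Equivalence.from T-∧ (≡⇒≡ᵇ x x refl , _)))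

record Overpartition (k n : ℕ) (l : OP) : Set where
  constructor overpartition
  field
    positive : All (λ p → 0 < proj₁ p) l
    sum≡     : sumSizes l ≡ n
    linked   : Linked _≽_ l
    plains≡  : nonOverlined l ≡ k

countedᵇ : (OP → Bool) → ℕ → ℕ → OP → Bool
countedᵇ P k n l = isOverpartitionᵇ n l ∧ (nonOverlined l ≡ᵇ k) ∧ P l

countedᵇ⇒ : ∀ P k n l → T (countedᵇ P k n l) → Overpartition k n l × T (P l)
countedᵇ⇒ P k n l t
  with isOp , t₁ ← Equivalence.to (T-∧ {isOverpartitionᵇ n l}) t
  with ks , Pl ← Equivalence.to (T-∧ {nonOverlined l ≡ᵇ k}) t₁
  with pos , t₂ ← Equivalence.to (T-∧ {all (λ p → 1 ≤ᵇ proj₁ p) l}) isOp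
  with sums , ord ← Equivalence.to (T-∧ {sumSizes l ≡ᵇ n}) t₂
  = overpartition (All.map (≤ᵇ⇒≤ 1 _) (All.all⁺ (λ p → 1 ≤ᵇ proj₁ p) l pos))
      (≡ᵇ⇒≡ _ _ sums) (orderedᵇ⇒linked l ord) (≡ᵇ⇒≡ _ _ ks)
  , Pl

countedᵇ⇐ : ∀ P k n l → Overpartition k n l → T (P l) → T (countedᵇ P k n l)
countedᵇ⇐ P k n l (overpartition pos sums ord ks) Pl = Equivalence.from T-∧
  ( Equivalence.from T-∧ (All.all⁻ (λ p → 1 ≤ᵇ proj₁ p) (All.map ≤⇒≤ᵇ pos)
  , Equivalence.from T-∧ (≡⇒≡ᵇ (sumSizes l) n sums , linked⇒orderedᵇ ord))
  , Equivalence.from T-∧ (≡⇒≡ᵇ (nonOverlined l) k ks , Pl))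

-- The gap condition in the integers

χ≡bit : ∀ c → χ c ≡ ℤ.+ bit c
χ≡bit true  = refl
χ≡bit false = refl

gapℤ : ℕ → ℕ → Bool → ℕ → ℕ → ℤ
gapℤ N w c v α = (ℤ.+ N) ℤ.* ((ℤ.+ w) ℤ.- ℤ.1ℤ ℤ.+ χ c) ℤ.+ (ℤ.+ v) ℤ.- (ℤ.+ α)

-- Both inequalities compare with 0 the same difference, which avoids any rearrangement of ≤ in ℤ.
gapℤ-difference : ∀ N m L c i α x →
  ((ℤ.+ x) ℤ.- (ℤ.+ (m * N + α))) ℤ.- gapℤ N (suc L) c i α ≡ (ℤ.+ x) ℤ.- (ℤ.+ ((m + L + bit c) * N + i))
gapℤ-difference N m L c i α x
  = trans (cong₂ (λ y b → ((ℤ.+ x) ℤ.- (y ℤ.+ ℤ.+ α)) ℤ.- ((ℤ.+ N) ℤ.* ((ℤ.+ suc L) ℤ.- ℤ.1ℤ ℤ.+ b) ℤ.+ (ℤ.+ i) ℤ.- (ℤ.+ α)))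
             (ℤ.pos-* m N) (χ≡bit c))
      (trans (lemma (ℤ.+ N) (ℤ.+ m) (ℤ.+ L) (ℤ.+ bit c) (ℤ.+ i) (ℤ.+ α) (ℤ.+ x))
        (cong (λ z → (ℤ.+ x) ℤ.- (z ℤ.+ ℤ.+ i)) (sym (ℤ.pos-* (m + L + bit c) N))))
  where
  lemma : ∀ N m L b i α x →
    (x ℤ.- (m ℤ.* N ℤ.+ α)) ℤ.- (N ℤ.* (ℤ.1ℤ ℤ.+ L ℤ.- ℤ.1ℤ ℤ.+ b) ℤ.+ i ℤ.- α) ≡ x ℤ.- ((m ℤ.+ L ℤ.+ b) ℤ.* N ℤ.+ i)
  lemma = ℤ.solve-∀

gapℤ⇒≤ : ∀ N m L c i α x → gapℤ N (suc L) c i α ℤ.≤ (ℤ.+ x) ℤ.- (ℤ.+ (m * N + α)) → (m + L + bit c) * N + i ≤ x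
gapℤ⇒≤ N m L c i α x le = ℤ.drop‿+≤+ (ℤ.0≤i-j⇒j≤i (subst (0ℤ ℤ.≤_) (gapℤ-difference N m L c i α x) (ℤ.i≤j⇒0≤j-i le)))

≤⇒gapℤ : ∀ N m L c i α x → (m + L + bit c) * N + i ≤ x → gapℤ N (suc L) c i α ℤ.≤ (ℤ.+ x) ℤ.- (ℤ.+ (m * N + α))
≤⇒gapℤ N m L c i α x le = ℤ.0≤i-j⇒j≤i (subst (0ℤ ℤ.≤_) (sym (gapℤ-difference N m L c i α x)) (ℤ.i≤j⇒0≤j-i (ℤ.+≤+ le)))

module Correspondence {r : ℕ} (a : Fin r → ℕ) (N : ℕ) (N>0 : 0 < N) (hyp : Superincreasing a N) where
  open Superincreasing hyp
  open Alphabet a N hyp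
  open Merged a N hyp
  open Coloured a N hyp

  inA⇒isCell : ∀ x → T (inA-Nᵇ a N x) → IsCell x
  inA⇒isCell x t
    with x>0 , t′ ← Equivalence.to (T-∧ {1 ≤ᵇ x}) t
    with i , _ , eq ← find (Any.any⁻ (λ i → (x mod N) ≡ᵇ (a i mod N)) (allFin r) t′)
    with m , eq′ ← mod-decompose N>0 x (a i) (≤ᵇ⇒≤ 1 x x>0) (a>0 i) (a≤N i) (≡ᵇ⇒≡ _ _ eq)
    = (m , i) , eq′

  isCell⇒>0 : ∀ {x} → IsCell x → 0 < x
  isCell⇒>0 ((m , i) , refl) = m≤n⇒m≤o+n (m * N) (a>0 i)

  isCell⇒inA : ∀ x → IsCell x → T (inA-Nᵇ a N x)
  isCell⇒inA x cell@((m , i) , refl) = Equivalence.from T-∧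
    ( ≤⇒≤ᵇ (isCell⇒>0 cell)
    , Any.any⁺ (λ j → (x mod N) ≡ᵇ (a j mod N)) (lose (∈-allFin i) (≡⇒≡ᵇ (x mod N) (a i mod N) (mod-size N>0 m (a i)))))

  inA′⇒block : ∀ x → T (inA′-Nᵇ a N x) → Block x
  inA′⇒block x t
    with x>0 , t′ ← Equivalence.to (T-∧ {1 ≤ᵇ x}) t
    with α , α∈ , eq ← find (Any.any⁻ (λ α → (x mod N) ≡ᵇ (α mod N)) (A′ a) t′)
    with S , S∈ , refl ← ∈-map⁻ (subsetSum a) α∈
    with i , B , S≡ ← nonemptyᵇ⇒indices S (proj₂ (∈-filter⁻ (λ S → T? (nonemptyᵇ S)) {xs = allSubsets r} S∈))
    with asc ← subst Ascending S≡ (indices-ascending S)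
    with m , eq′ ← mod-decompose N>0 x (sumOf a (i ∷ B)) (≤ᵇ⇒≤ 1 x x>0) (sumOf>0 i B) (sumOf≤N (i ∷ B) asc)
           (trans (≡ᵇ⇒≡ _ _ eq) (cong (_mod N) (subsetSum≡sumOf S S≡)))
    = record { level = m ; lead = i ; others = B ; ascending = asc ; size≡ = eq′ }

  block⇒>0 : ∀ {x} → Block x → 0 < x
  block⇒>0 B = subst (0 <_) (sym size≡) (m≤n⇒m≤o+n (level * N) (sumOf>0 lead others))
    where open Block B

  block⇒inA′ : ∀ x → Block x → T (inA′-Nᵇ a N x)
  block⇒inA′ x B = found (ascending⇒indices (lead ∷ others) ascending)
    where
    open Block B
    found : (∃ λ S → indices S ≡ lead ∷ others) → T (inA′-Nᵇ a N x)
    found (S , S≡) = Equivalence.from T-∧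
      ( ≤⇒≤ᵇ (block⇒>0 B)
      , Any.any⁺ (λ α → (x mod N) ≡ᵇ (α mod N))
          (lose (∈-map⁺ (subsetSum a) (∈-filter⁺ (λ S → T? (nonemptyᵇ S)) (∈-allSubsets S)
                  (nonempty⇒nonemptyᵇ S (indices-nonempty S S≡))))
            (≡⇒≡ᵇ (x mod N) (subsetSum a S mod N)
              (trans (cong (_mod N) size≡) (trans (mod-size N>0 level _) (cong (_mod N) (sym (subsetSum≡sumOf S S≡))))))))

  -- Evaluates `β`, `w` and `v` at a block: the residue is the subset sum, with its cardinality and
  -- its smallest element.
  gapᵇ≡ : ∀ x b y c (B : Block y) → let open Block B in
    gapᵇ a N (x , b) (y , c)
    ≡ (gapℤ N (suc (length others)) c (a lead) (sumOf a (lead ∷ others)) ℤ.≤ᵇ (ℤ.+ x) ℤ.- (ℤ.+ size level (sumOf a (lead ∷ others))))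
  gapᵇ≡ x b y c B = trans (cong (λ y → gapᵇ a N (x , b) (y , c)) size≡)
    (subst (λ β′ → (gapℤ N (w a β′) c (v a β′) β′ ℤ.≤ᵇ (ℤ.+ x) ℤ.- (ℤ.+ y′)) ≡ target) (sym β≡)
      (cong₂ (λ w′ v′ → gapℤ N w′ c v′ α ℤ.≤ᵇ (ℤ.+ x) ℤ.- (ℤ.+ y′)) (w≡length lead others ascending) (v≡a lead others ascending)))
    where
    open Block B
    α = sumOf a (lead ∷ others)
    y′ = size level α
    target = gapℤ N (suc (length others)) c (a lead) α ℤ.≤ᵇ (ℤ.+ x) ℤ.- (ℤ.+ y′)
    β≡ : β N y′ ≡ α
    β≡ = β-size N>0 level α (sumOf>0 lead others) (sumOf≤N _ ascending)

  gapᵇ⇒Gap : ∀ {x b y c} → Block y → T (gapᵇ a N (x , b) (y , c)) → Gap x (y , c)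
  gapᵇ⇒Gap {x} {b} {y} {c} B t = B
    , gapℤ⇒≤ N level (length others) c (a lead) (sumOf a (lead ∷ others)) x (ℤ.≤ᵇ⇒≤ (subst T (gapᵇ≡ x b y c B) t))
    where open Block B

  Gap⇒gapᵇ : ∀ {x b y c} → Gap x (y , c) → T (gapᵇ a N (x , b) (y , c))
  Gap⇒gapᵇ {x} {b} {y} {c} (B , le) = subst T (sym (gapᵇ≡ x b y c B))
    (ℤ.≤⇒≤ᵇ (≤⇒gapℤ N level (length others) c (a lead) (sumOf a (lead ∷ others)) x le))
    where open Block B

  spacedᵇ : OP → Bool
  spacedᵇ l = all (λ p → inA′-Nᵇ a N (proj₁ p)) l ∧ adjacentᵇ (gapᵇ a N) l

  spacedᵇ⇒ : ∀ l → T (spacedᵇ l) → Spaced l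
  spacedᵇ⇒ l t with blocks , gaps ← Equivalence.to (T-∧ {all (λ p → inA′-Nᵇ a N (proj₁ p)) l}) t
    = go l (All.map (inA′⇒block _) (All.all⁺ (λ p → inA′-Nᵇ a N (proj₁ p)) l blocks)) gaps
    where
    go : ∀ l → All (Block ∘ proj₁) l → T (adjacentᵇ (gapᵇ a N) l) → Spaced l
    go [] _ _ = nil
    go (p ∷ []) (B ∷ []) _ = one B
    go (p ∷ q ∷ l) (B ∷ B′ ∷ Bs) t = let g , t′ = Equivalence.to (T-∧ {gapᵇ a N p q}) t in
      cons B (gapᵇ⇒Gap {b = proj₂ p} B′ g) (go (q ∷ l) (B′ ∷ Bs) t′)

  spaced⇒blocks : ∀ {l} → Spaced l → All (Block ∘ proj₁) l
  spaced⇒blocks nil           = []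
  spaced⇒blocks (one B)       = B ∷ []
  spaced⇒blocks (cons B _ sp) = B ∷ spaced⇒blocks sp

  spaced⇒gaps : ∀ {l} → Spaced l → T (adjacentᵇ (gapᵇ a N) l)
  spaced⇒gaps nil           = _
  spaced⇒gaps (one B)       = _
  spaced⇒gaps (cons {x} {χ} B g sp) = Equivalence.from T-∧ (Gap⇒gapᵇ {x} {χ} g , spaced⇒gaps sp)

  spaced⇒spacedᵇ : ∀ {l} → Spaced l → T (spacedᵇ l)
  spaced⇒spacedᵇ sp = Equivalence.from T-∧
    (All.all⁻ (λ p → inA′-Nᵇ a N (proj₁ p)) (All.map (block⇒inA′ _) (spaced⇒blocks sp)) , spaced⇒gaps sp)

  -- Spaced lists are ordered automatically. An overline or a second colour in the smaller part
  -- raises the required level by at least one, so equality can occur only for a single colour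
  -- without overline.
  gap⇒≽ : ∀ {x b q} → Gap x q → (x , b) ≽ q
  gap⇒≽ {x} {b} {y , c} (record { level = m ; lead = i ; others = [] ; size≡ = refl } , le) = by-overline c le
    where
    by-overline : ∀ c → size (m + 0 + bit c) (a i) ≤ x → (x , b) ≽ (size m (a i + 0) , c)
    by-overline true le = inj₁ (<-≤-trans (size-mono-< {m} (≤-reflexive (trans (+-comm 1 m) (cong (_+ 1) (sym (+-identityʳ m)))))
                                   (subst (_≤ N) (sym (+-identityʳ (a i))) (a≤N i)) (a>0 i)) le)
    by-overline false le with m≤n⇒m<n∨m≡n (subst (_≤ x) (cong₂ size (trans (+-identityʳ _) (+-identityʳ m)) (sym (+-identityʳ (a i)))) le)
    ... | inj₁ lt = inj₁ lt
    ... | inj₂ eq = inj₂ (sym eq , refl)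
  gap⇒≽ {x} {b} {y , c} (record { level = m ; lead = i ; others = j ∷ B ; ascending = asc ; size≡ = refl } , le)
    = inj₁ (<-≤-trans (size-mono-< {m} (m≤n⇒m≤n+o (bit c) (subst (suc m ≤_) (sym (+-suc m (length B))) (s≤s (m≤m+n m _))))
                        (sumOf≤N _ asc) (a>0 i)) le)

  spaced⇒linked : ∀ {l} → Spaced l → Linked _≽_ l
  spaced⇒linked nil           = []
  spaced⇒linked (one _)       = [-]
  spaced⇒linked (cons {x} {χ} _ g sp) = gap⇒≽ {x} {χ} g ∷ spaced⇒linked sp

  -- Both overpartitions come from the same word and code. A relation is enough for counting, so no
  -- decoding function is needed.
  Corresponds : OP → OP → Set
  Corresponds x y = Σ Word λ (u , c) → encE u c ≡ x × Decodes u (taus c) (sigs c) y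

  lengths≡ : ∀ (u : List (Fin r)) (c : Code (flags u)) → length (taus c) + length (sigs c) ≡ length u
  lengths≡ u c = trans (length-taus+sigs c) (length-flags u)

  corresponds-injective : ∀ {x x′ y} → Corresponds x y → Corresponds x′ y → x ≡ x′
  corresponds-injective ((u , c) , refl , dec) ((u′ , c′) , refl , dec′)
    with refl , τ≡ , σ≡ ← decodes-injective (lengths≡ u c) (lengths≡ u′ c′) dec dec′
    with refl ← taus,sigs-injective c c′ τ≡ σ≡ = refl

  corresponds-functional : ∀ {x y y′} → Corresponds x y → Corresponds x y′ → y ≡ y′
  corresponds-functional ((u , c) , eq , dec) ((u′ , c′) , eq′ , dec′)
    with refl ← encE-injective u c u′ c′ (trans eq (sym eq′)) = decodes-functional dec dec′

  inAᵇ : OP → Bool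
  inAᵇ l = all (λ p → inA-Nᵇ a N (proj₁ p)) l

  -- The two sums are the same letters plus `N` times the levels, so `weight≡total` equates them;
  -- the length of `sigs c` counts the non-overlined parts on both sides.
  E⇒D : ∀ k n x → T (countedᵇ spacedᵇ k n x) →
    ∃ λ y → y ∈ candidates n × T (countedᵇ inAᵇ k n y) × Corresponds x y
  E⇒D k n x t
    with overpartition pos sum≡ linked plains≡ , sp ← countedᵇ⇒ spacedᵇ k n x t
    with u , c , refl ← encE-surjective (spacedᵇ⇒ x sp)
    with y , dec ← decodes-exists u (taus c) (sigs c)
    = y , ∈-candidates n y pos′ sum′
    , countedᵇ⇐ inAᵇ k n y
        (overpartition pos′ sum′ (AllPairs⇒Linked (Decodes.sorted dec))
          (trans (decodes-plains (lengths≡ u c) dec) (trans (length-sigs c) (trans (sym (encE-plains u c)) plains≡))))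
        (All.all⁻ (λ p → inA-Nᵇ a N (proj₁ p)) (All.map (isCell⇒inA _) (decodes-isCell dec)))
    , (u , c) , refl , dec
    where
    pos′ = All.map isCell⇒>0 (decodes-isCell dec)
    sum′ = trans (decodes-sum (lengths≡ u c) dec)
      (trans (cong (λ s → size s (sumOf a u)) (sym (weight≡total c))) (trans (sym (encE-sum u c)) sum≡))

  D⇒E : ∀ k n y → T (countedᵇ inAᵇ k n y) →
    ∃ λ x → x ∈ candidates n × T (countedᵇ spacedᵇ k n x) × Corresponds x y
  D⇒E k n y t
    with overpartition pos sum≡ linked plains≡ , cells ← countedᵇ⇒ inAᵇ k n y t
    with u , τ , σ , len , dec ← decodes-surjective y (Linked⇒AllPairs (λ {p} {q} {s} → ≽-trans {p} {q} {s}) linked)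
           (All.map (inA⇒isCell _) (All.all⁺ (λ p → inA-Nᵇ a N (proj₁ p)) y cells))
    with c , refl , refl ← taus,sigs-surjective (flags u) τ σ (trans len (sym (length-flags u)))
    = encE u c , ∈-candidates n (encE u c) pos′ sum′
    , countedᵇ⇐ spacedᵇ k n (encE u c)
        (overpartition pos′ sum′ (spaced⇒linked (encE-spaced u c))
          (trans (encE-plains u c) (trans (sym (length-sigs c)) (trans (sym (decodes-plains len dec)) plains≡))))
        (spaced⇒spacedᵇ (encE-spaced u c))
    , (u , c) , refl , dec
    where
    pos′ = All.map block⇒>0 (spaced⇒blocks (encE-spaced u c))
    sum′ = trans (encE-sum u c) (trans (cong (λ s → size s (sumOf a u)) (weight≡total c))
      (trans (sym (decodes-sum len dec)) sum≡))

  D≡E : ∀ k n → D a N k n ≡ E a N k n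
  D≡E k n = sym (length-filter-bijection Corresponds (countedᵇ spacedᵇ k n) (countedᵇ inAᵇ k n) (candidates n)
    (seqs-unique n n) corresponds-injective corresponds-functional (E⇒D k n) (D⇒E k n))

theorem6 : (r : ℕ) → 1 ≤ r → (a : Fin r → ℕ) → Injective _≡_ _≡_ a →
    (∀ (k : Fin r) → sum (take (toℕ k) (tabulate a)) < a k) →
    (∀ (S T : Subset r) → Nonempty S → Nonempty T → subsetSum a S ≡ subsetSum a T → S ≡ T) →
    (N : ℕ) → 1 ≤ N → sum (tabulate a) ≤ N →
    ∀ (k n : ℕ) → D a N k n ≡ E a N k n
theorem6 r _ a _ superincreasing distinct-sums N N>0 total≤N = Correspondence.D≡E a N N>0
  (record { superincreasing = superincreasing ; distinct-sums = distinct-sums ; total≤N = total≤N })
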